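{- Let $q$ be a power of an odd prime, let $d\geq 1$ and $k\geq d$ be integers. Then \[ |\Delta_k(\mathbb{F}_q^d)|\approx q^{d(k+1)-\binom{d+1}{2}}, \] i.e. there are positive constants $c_1,c_2$ (independent of $q$) such that $c_1 q^{d(k+1)-\binom{d+1}{2}}\leq |\Delta_k(\mathbb{F}_q^d)|\leq c_2 q^{d(k+1)-\binom{d+1}{2}}$.
   Context: $\mathbb{F}_q^d$ is equipped with the dot product $x\cdot y=\sum_{i=1}^d x_iy_i$, and $O(\mathbb{F}_q^d)$ denotes the group of linear maps $\theta:\mathbb{F}_q^d\to\mathbb{F}_q^d$ with $\theta x\cdot\theta y=x\cdot y$ for all $x,y$ ("rotations"). A $(k+1)$-point configuration is a tuple $x=(x^1,\dots,x^{k+1})\in(\mathbb{F}_q^d)^{k+1}$. Two configurations $x,y$ are congruent, $x\sim y$, if there exist $\theta\in O(\mathbb{F}_q^d)$ and $z\in\mathbb{F}_q^d$ with $y^i=\theta x^i+z$ for every $i$. For $E\subset\mathbb{F}_q^d$, $\Delta_k(E)$ is the set of congruence classes of $(k+1)$-point configurations all of whose entries lie in $E$. The implicit constants in $\approx$ are allowed to depend on $d$ (the paper's convention). -}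

module Defs where

open import Algebra.Apartness.Bundles using (HeytingField; HeytingCommutativeRing)
open import Algebra.Bundles using (CommutativeRing)
open import Algebra.Module.Bundles.Raw using (RawLeftModule)
open import Algebra.Module.Morphism.Structures using (module LeftModuleMorphisms)
import Algebra.Properties.CommutativeMonoid.Sum as Sum
open import Data.Fin.Base using (Fin)
import Data.Integer.Base as ℤ
open import Data.Nat.Base using (ℕ; suc; _^_; _≤_)
open import Data.Nat.Primality using (Prime)
open import Data.Product.Base using (Σ-syntax; ∃-syntax; _×_; proj₁)
open import Data.Rational.Base as ℚ using (ℚ)
open import Data.Vec.Functional using (Vector; map; zipWith; replicate)
open import Data.Vec.Functional.Relation.Binary.Pointwise using (Pointwise)
open import Function.Base using (_on_)
open import Function.Definitions using (Congruent; Bijective)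
open import Level using (Level; _⊔_)
open import Relation.Binary.Core using (Rel)
open import Relation.Binary.PropositionalEquality.Core using (_≡_; _≢_)
open import Relation.Unary using (Pred)

-- The quotient of A by _~_ has exactly n elements.  No proof that _~_ is
-- an equivalence is asked for: congruence and injectivity together say
-- that _~_ is the kernel of the map to Fin n, hence an equivalence.
HasCardinality : ∀ {a ℓ} {A : Set a} → Rel A ℓ → ℕ → Set (a ⊔ ℓ)
HasCardinality {A = A} _~_ n =
  Σ[ f ∈ (A → Fin n) ] Congruent _~_ _≡_ f × Bijective _~_ _≡_ f

IsOddPrimePower : ℕ → Set
IsOddPrimePower q =
  ∃[ p ] ∃[ m ] Prime p × p ≢ 2 × 1 ≤ m × q ≡ p ^ m

fromℕ : ℕ → ℚ
fromℕ n = ℤ.+ n ℚ./ 1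

-- Constructively a field is a HeytingField; when the carrier is finite
-- its apartness _#_ is necessarily the negation of _≈_.
module Configurations {c ℓ₁ ℓ₂ : Level} (F : HeytingField c ℓ₁ ℓ₂) where

  open HeytingField F
  open HeytingCommutativeRing heytingCommutativeRing using (commutativeRing)
  open CommutativeRing commutativeRing using (+-commutativeMonoid)
  open Sum +-commutativeMonoid using (sum)

  Space : ℕ → RawLeftModule Carrier c ℓ₁
  Space d = record
    { Carrierᴹ = Vector Carrier d
    ; _≈ᴹ_     = Pointwise _≈_
    ; _+ᴹ_     = zipWith _+_
    ; _*ₗ_     = λ a → map (a *_)
    ; 0ᴹ       = replicate d 0#
    ; -ᴹ_      = map (-_)
    }

  module _ {d : ℕ} where

    open RawLeftModule (Space d)
    open LeftModuleMorphisms (Space d) (Space d)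

    infix 8 _·_
    _·_ : Carrierᴹ → Carrierᴹ → Carrier
    x · y = sum (zipWith _*_ x y)

    record IsOrthogonal (θ : Carrierᴹ → Carrierᴹ) : Set (c ⊔ ℓ₁) where
      field
        isLinear      : IsLeftModuleHomomorphism θ
        ·-preserving  : ∀ x y → θ x · θ y ≈ x · y

    Configuration : ℕ → Set c
    Configuration k = Vector Carrierᴹ (suc k)

    infix 4 _∼_
    _∼_ : ∀ {k} → Rel (Configuration k) (c ⊔ ℓ₁)
    x ∼ y = ∃[ θ ] IsOrthogonal θ × (∃[ z ] ∀ i → y i ≈ᴹ θ (x i) +ᴹ z)

    ConfigurationIn : ∀ {e} → Pred Carrierᴹ e → ℕ → Set (c ⊔ e)
    ConfigurationIn E k = Σ[ x ∈ Configuration k ] (∀ i → E (x i))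

    -- Δ_k(E) is the quotient of ConfigurationIn E k by this relation.
    Congruence : ∀ {e} (E : Pred Carrierᴹ e) (k : ℕ) →
                 Rel (ConfigurationIn E k) (c ⊔ ℓ₁)
    Congruence E k = _∼_ on proj₁

  FieldHasOrder : ℕ → Set (c ⊔ ℓ₁)
  FieldHasOrder q = HasCardinality _≈_ q

  ΔHasCardinality : ∀ {e} (d k : ℕ) → Pred (Vector Carrier d) e → ℕ →
                    Set (c ⊔ ℓ₁ ⊔ e)
  ΔHasCardinality d k E n = HasCardinality (Congruence E k) n

{-# OPTIONS --safe #-}

-- Differences with the first point reduce congruence to the action of the
-- orthogonal group on k-tuples.  By Witt's theorem a tuple is determined up to
-- that action by reading it from left to right: a vector in the span of the
-- earlier ones is recorded by its coordinates in the basis collected so far,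
-- any other vector joins the basis and is recorded by its dot products.  These
-- codes are a complete invariant, and counting them bounds the number of
-- classes above.  Below, an upper triangular d × d matrix with nonzero diagonal
-- is determined by its Gram matrix up to the d signs on the diagonal, and the
-- remaining k − d vectors by their products with its rows; so classes of
-- (0, triangular rows, arbitrary vectors) are hit at most 2 ^ d times.

module Submission where

open import Defs
open import Algebra.Apartness.Bundles using (HeytingField; HeytingCommutativeRing)
open import Algebra.Bundles using (CommutativeRing)
open import Algebra.Module.Bundles.Raw using (RawLeftModule)
open import Algebra.Module.Morphism.Structures using (module LeftModuleMorphisms)
import Algebra.Properties.Ring as RingProperties
import Algebra.Properties.Semiring.Mult as SemiringMult
import Algebra.Properties.Semiring.Sum as SemiringSum
import Algebra.Solver.Ring.NaturalCoefficients.Default as SemiringSolver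
open import Data.Bool.Base using (Bool)
open import Data.Fin.Base as Fin using (Fin; zero; suc; punchIn; splitAt; _↑ˡ_; _↑ʳ_)
open import Data.Fin.Permutation using (Permutation; permutation; _⟨$⟩ʳ_)
import Data.Fin.Properties as Fin
import Data.Integer.Base as ℤ
import Data.Integer.Properties as ℤ
open import Data.Nat.Base as ℕ using (ℕ; zero; suc)
open import Data.Nat.DivMod using (m≡m%n+[m/n]*n; m%n<n)
open import Data.Nat.Divisibility using (_∣_; ∣1⇒≡1; m%n≡0⇒n∣m)
open import Data.Nat.Primality using (prime[2]; prime⇒irreducible; euclidsLemma)
import Data.Nat.Properties as ℕ
open import Data.Product.Base using (∃-syntax; Σ-syntax; _×_; _,_; proj₁; proj₂; uncurry)
open import Data.Product.Function.NonDependent.Propositional using (_×-↔_)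
open import Data.Product.Properties using (,-injective)
open import Data.Rational.Base as ℚ using (ℚ; 0ℚ)
import Data.Rational.Properties as ℚ
import Data.Rational.Unnormalised.Base as ℚᵘ
import Data.Rational.Unnormalised.Properties as ℚᵘ
open import Data.Sum.Base using (_⊎_; inj₁; inj₂; [_,_]′)
open import Data.Sum.Function.Propositional using (_⊎-↔_)
open import Data.Sum.Properties using (inj₁-injective; inj₂-injective)
open import Data.Unit.Base using (⊤; tt)
open import Data.Vec.Base as Vec using (Vec; []; _∷_; lookup)
import Data.Vec.Functional as Vector
import Data.Vec.Properties as Vec
open import Data.Vec.Relation.Binary.Pointwise.Inductive using (Pointwise; []; _∷_)
open import Data.Vec.Relation.Unary.All as All using (All; []; _∷_)
open import Function.Base using (_∘_)
open import Function.Bundles using (_↔_; mk↔ₛ′; Inverse; Injection)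
open import Function.Definitions using (Injective)
open import Function.Properties.Inverse using (↔-refl; ↔-sym; ↔-trans; Inverse⇒Injection)
open import Level using (Level; _⊔_)
open import Relation.Binary.Core using (Rel)
open import Relation.Binary.Definitions using (tri<; tri≈; tri>)
open import Relation.Binary.PropositionalEquality.Core as ≡ using (_≡_)
open import Relation.Nullary.Decidable using (Dec; yes; no; does; dec-true; dec-false; map′; ¬?; decidable-stable)
open import Relation.Nullary.Negation using (¬_; contradiction)
open import Relation.Unary using (U)

-- The Gram matrix alone does not classify tuples: a nonzero vector may be orthogonal to itself, and
-- then all its recorded products can agree with those of the zero vector. So linear relations have
-- to be stored as well, and Witt's theorem cannot be reduced to orthogonal bases, since spans may
-- be degenerate. Instead an isometry is corrected one basis vector at a time: a reflection moves
-- one vector to another when their difference is anisotropic, and a second explicit isometry does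
-- so when it is isotropic; the latter needs the two vectors to lie outside the span already
-- matched. The exponent comes from codes of full rank. The basis vectors have q, q ^ 2, ..., q ^ d
-- possible records and each of the other k - d vectors has q ^ d, which gives q to the power d (k -
-- d) + (d + 1) C 2, and this is d (k + 1) - (d + 1) C 2. Codes of smaller rank change the count by
-- at most a factor depending on d, because a dependent vector read after r basis vectors has only q
-- ^ r possible records.

OddCharacteristic : ∀ {c ℓ₁ ℓ₂} → HeytingField c ℓ₁ ℓ₂ → Set ℓ₁
OddCharacteristic F = ¬ (1# + 1# ≈ 0#)
  where open HeytingField F

-- Arithmetic in a finite field

module FiniteField {c ℓ₁ ℓ₂} (F : HeytingField c ℓ₁ ℓ₂) (q : ℕ)
                   (order : Configurations.FieldHasOrder F q) where

  open HeytingField F using (heytingCommutativeRing; #⇒invertible; tight)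
  open HeytingCommutativeRing heytingCommutativeRing public using (commutativeRing)
  open CommutativeRing commutativeRing public hiding (zero; _≉_)
  open import Algebra.Apartness.Properties.HeytingCommutativeRing heytingCommutativeRing
    using (x-0≈x; 1#0)
  open RingProperties ring public using (-‿distribˡ-*; -1*x≈-x; -‿involutive; -‿+-comm; x∙y⁻¹≈ε⇒x≈y)

  infix 4 _≉_
  _≉_ : Carrier → Carrier → Set ℓ₁
  x ≉ y = ¬ (x ≈ y)

  index : Carrier → Fin q
  index = proj₁ order

  index-cong : ∀ {x y} → x ≈ y → index x ≡ index y
  index-cong = proj₁ (proj₂ order)

  index-injective : ∀ {x y} → index x ≡ index y → x ≈ y
  index-injective = proj₁ (proj₂ (proj₂ order))

  element : Fin q → Carrier
  element i = proj₁ (proj₂ (proj₂ (proj₂ order)) i)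

  index-element : ∀ i → index (element i) ≡ i
  index-element i = proj₂ (proj₂ (proj₂ (proj₂ order)) i) refl

  element-index : ∀ x → element (index x) ≈ x
  element-index x = index-injective (index-element (index x))

  element-injective : ∀ {i j} → element i ≈ element j → i ≡ j
  element-injective {i} {j} eq =
    ≡.trans (≡.sym (index-element i)) (≡.trans (index-cong eq) (index-element j))

  1≉0 : 1# ≉ 0#
  1≉0 1≈0 = proj₂ (tight 1# 0#) 1≈0 1#0

  1<q : 1 ℕ.< q
  1<q = distinct (1≉0 ∘ index-injective)
    where
    distinct : ∀ {n} {i j : Fin n} → ¬ (i ≡ j) → 1 ℕ.< n
    distinct {1}           {zero} {zero} i≢j = contradiction ≡.refl i≢j
    distinct {suc (suc n)}               i≢j = ℕ.s≤s (ℕ.s≤s ℕ.z≤n)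

  infix 4 _≟_
  _≟_ : ∀ x y → Dec (x ≈ y)
  x ≟ y = map′ index-injective index-cong (index x Fin.≟ index y)

  -- Tightness only makes a nonzero element non-non-invertible; invertibility
  -- itself is decided by searching the finite carrier.
  inverse : ∀ {x} → x ≉ 0# → ∃[ y ] y * x ≈ 1#
  inverse {x} x≉0 with Fin.any? (λ i → element i * x ≟ 1#)
  ... | yes (i , eq) = element i , eq
  ... | no ∄inv      = contradiction (proj₁ (tight x 0#) ¬x#0) x≉0
    where
    ¬x#0 : ¬ HeytingField._#_ F x 0#
    ¬x#0 x#0 with #⇒invertible x#0
    ... | y , yx≈1 , _ = ∄inv (index y ,
            trans (*-cong (element-index y) (sym (x-0≈x x))) yx≈1)

  *-cancelˡ : ∀ {x y z} → x ≉ 0# → x * y ≈ x * z → y ≈ z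
  *-cancelˡ {x} {y} {z} x≉0 xy≈xz with inverse x≉0
  ... | x⁻¹ , x⁻¹x≈1 = trans (sym (undo y)) (trans (*-congˡ xy≈xz) (undo z))
    where
    undo : ∀ w → x⁻¹ * (x * w) ≈ w
    undo w = trans (sym (*-assoc x⁻¹ x w)) (trans (*-congʳ x⁻¹x≈1) (*-identityˡ w))

  +-cancelʳ : ∀ {x y z} → y + x ≈ z + x → y ≈ z
  +-cancelʳ {x} {y} {z} = RingProperties.+-cancelʳ ring x y z

  +-cancelˡ : ∀ {x y z} → x + y ≈ x + z → y ≈ z
  +-cancelˡ {x} {y} {z} = RingProperties.+-cancelˡ ring x y z

  open SemiringSolver commutativeSemiring public
    using (solve; _:+_; _:*_; _:=_; con)

  open Configurations F using (_·_)

  basisVector : ∀ {n} → Fin n → Fin n → Carrier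
  basisVector zero    zero    = 1#
  basisVector zero    (suc j) = 0#
  basisVector (suc i) zero    = 0#
  basisVector (suc i) (suc j) = basisVector i j

  basisVector-· : ∀ {n} (i : Fin n) (u : Fin n → Carrier) → basisVector i · u ≈ u i
  basisVector-· zero    u = trans (+-cong (*-identityˡ (u zero)) (zeros (u ∘ suc))) (+-identityʳ (u zero))
    where
    zeros : ∀ {n} (w : Fin n → Carrier) → (λ _ → 0#) · w ≈ 0#
    zeros {zero}  w = refl
    zeros {suc n} w = trans (+-cong (zeroˡ (w zero)) (zeros (w ∘ suc))) (+-identityʳ 0#)
  basisVector-· (suc i) u = trans (+-cong (zeroˡ (u zero)) (basisVector-· i (u ∘ suc))) (+-identityˡ (u (suc i)))

-- Translation by 1 permutes the field, so comparing the sums of all elements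
-- before and after gives q × 1 ≈ 0.
odd-order⇒2≉0 : ∀ {c ℓ₁ ℓ₂} (F : HeytingField c ℓ₁ ℓ₂) q (order : Configurations.FieldHasOrder F q) →
  ∃[ j ] q ≡ 1 ℕ.+ j ℕ.* 2 → OddCharacteristic F
odd-order⇒2≉0 F q order (j , q≡1+2j) 2≈0 = 1≉0 (begin
  1#                                          ≈⟨ +-identityʳ 1# ⟨
  1# + 0#                                     ≈⟨ +-congˡ (zeroʳ (j ×′ 1#)) ⟨
  1# + (j ×′ 1#) * 0#                         ≈⟨ +-congˡ (*-congˡ (trans (+-congˡ (+-identityʳ 1#)) 2≈0)) ⟨
  1# + (j ×′ 1#) * (2 ×′ 1#)                  ≈⟨ +-congˡ (×1-homo-* j 2) ⟨
  (1 ℕ.+ j ℕ.* 2) ×′ 1#                       ≡⟨ ≡.cong (_×′ 1#) q≡1+2j ⟨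
  q ×′ 1#                                     ≈⟨ sum-replicate q ⟨
  sum (Vector.replicate q 1#)                 ≈⟨ total ⟩
  0#                                 ∎)
  where
  open FiniteField F q order
  open SemiringSum semiring using (sum; sum-permute; sum-cong-≋; ∑-distrib-+; sum-replicate)
  open SemiringMult semiring using (×1-homo-*) renaming (_×_ to _×′_)
  open import Relation.Binary.Reasoning.Setoid setoid
  translate : Carrier → Fin q → Fin q
  translate a i = index (element i + a)
  inverseTo : ∀ a b → a + b ≈ 0# → ∀ i → translate b (translate a i) ≡ i
  inverseTo a b a+b≈0 i = ≡.trans (index-cong (begin
    element (translate a i) + b                 ≈⟨ +-congʳ (element-index _) ⟩
    element i + a + b                           ≈⟨ +-assoc (element i) a b ⟩
    element i + (a + b)                         ≈⟨ +-congˡ a+b≈0 ⟩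
    element i + 0#                              ≈⟨ +-identityʳ _ ⟩
    element i                     ∎)) (index-element i)
  π : Permutation q q
  π = permutation (translate 1#) (translate (- 1#))
        (inverseTo (- 1#) 1# (-‿inverseˡ 1#)) (inverseTo 1# (- 1#) (-‿inverseʳ 1#))
  total : sum (Vector.replicate q 1#) ≈ 0#
  total = +-cancelˡ {sum element} (begin
    sum element + sum (Vector.replicate q 1#)   ≈⟨ ∑-distrib-+ element (Vector.replicate q 1#) ⟨
    sum (λ i → element i + 1#)                  ≈⟨ sum-cong-≋ (λ i → element-index (element i + 1#)) ⟨
    sum (element ∘ (π ⟨$⟩ʳ_))                   ≈⟨ sum-permute element π ⟨
    sum element                                 ≈⟨ +-identityʳ _ ⟨
    sum element + 0#                     ∎)

-- Spans, dual vectors and explicit isometries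

module LinearAlgebra {c ℓ₁ ℓ₂} (F : HeytingField c ℓ₁ ℓ₂) (q : ℕ)
                     (order : Configurations.FieldHasOrder F q) (d : ℕ) where

  open FiniteField F q order
  open Configurations F
  open RawLeftModule (Space d) using (_≈ᴹ_; _+ᴹ_; _*ₗ_; 0ᴹ; -ᴹ_) renaming (Carrierᴹ to V)
  open LeftModuleMorphisms (Space d) (Space d) using (module IsLeftModuleHomomorphism)
  open SemiringSum semiring using (sum-cong-≋; ∑-distrib-+; *-distribˡ-sum)
  open import Relation.Binary.Reasoning.Setoid setoid

  ·-cong : ∀ {x x′ y y′ : V} → x ≈ᴹ x′ → y ≈ᴹ y′ → x · y ≈ x′ · y′
  ·-cong x≈x′ y≈y′ = sum-cong-≋ λ i → *-cong (x≈x′ i) (y≈y′ i)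

  ·-comm : ∀ (x y : V) → x · y ≈ y · x
  ·-comm x y = sum-cong-≋ λ i → *-comm (x i) (y i)

  ·-distribˡ : ∀ (x y z : V) → x · (y +ᴹ z) ≈ x · y + x · z
  ·-distribˡ x y z =
    trans (sum-cong-≋ λ i → distribˡ (x i) (y i) (z i))
          (∑-distrib-+ (λ i → x i * y i) (λ i → x i * z i))

  ·-distribʳ : ∀ (x y z : V) → (y +ᴹ z) · x ≈ y · x + z · x
  ·-distribʳ x y z =
    trans (sum-cong-≋ λ i → distribʳ (x i) (y i) (z i))
          (∑-distrib-+ (λ i → y i * x i) (λ i → z i * x i))

  ·-homoˡ : ∀ a (x y : V) → (a *ₗ x) · y ≈ a * (x · y)
  ·-homoˡ a x y =
    trans (sum-cong-≋ λ i → *-assoc a (x i) (y i))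
          (sym (*-distribˡ-sum a (λ i → x i * y i)))

  ·-homoʳ : ∀ a (x y : V) → x · (a *ₗ y) ≈ a * (x · y)
  ·-homoʳ a x y = trans (·-comm x _) (trans (·-homoˡ a y x) (*-congˡ (·-comm y x)))

  ·-zeroʳ : ∀ (x : V) → x · 0ᴹ ≈ 0#
  ·-zeroʳ x = begin
    x · 0ᴹ              ≈⟨ ·-cong {x} {x} (λ _ → refl) (λ _ → sym (zeroˡ 0#)) ⟩
    x · (0# *ₗ 0ᴹ)      ≈⟨ ·-homoʳ 0# x 0ᴹ ⟩
    0# * (x · 0ᴹ)       ≈⟨ zeroˡ _ ⟩
    0#                  ∎

  ·-axpyʳ : ∀ a (x y z : V) → z · (x +ᴹ a *ₗ y) ≈ z · x + a * (z · y)
  ·-axpyʳ a x y z = trans (·-distribˡ z x (a *ₗ y)) (+-congˡ (·-homoʳ a z y))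

  ·-axpyˡ : ∀ a (x y z : V) → (x +ᴹ a *ₗ y) · z ≈ x · z + a * (y · z)
  ·-axpyˡ a x y z = trans (·-distribʳ z x (a *ₗ y)) (+-congˡ (·-homoˡ a y z))

  combination : ∀ {r} → Vec Carrier r → Vec V r → V
  combination []       []      = 0ᴹ
  combination (a ∷ as) (v ∷ b) = a *ₗ v +ᴹ combination as b

  combination-cong : ∀ {r} {as as′ : Vec Carrier r} (b : Vec V r) →
                     Pointwise _≈_ as as′ → combination as b ≈ᴹ combination as′ b
  combination-cong []      []       i = refl
  combination-cong (v ∷ b) (e ∷ es) i = +-cong (*-congʳ e) (combination-cong b es i)

  infix 4 _⊥_
  _⊥_ : ∀ {r} → V → Vec V r → Set _
  a ⊥ b = All (λ v → a · v ≈ 0#) b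

  ⊥-combination : ∀ {r} a {b : Vec V r} (as : Vec Carrier r) → a ⊥ b →
                  a · combination as b ≈ 0#
  ⊥-combination a []       []           = ·-zeroʳ a
  ⊥-combination a {v ∷ b} (e ∷ as) (a⊥v ∷ a⊥b) = begin
    a · (e *ₗ v +ᴹ combination as b)    ≈⟨ ·-distribˡ a (e *ₗ v) (combination as b) ⟩
    a · (e *ₗ v) + a · combination as b
      ≈⟨ +-cong (trans (·-homoʳ e a v) (*-congˡ a⊥v)) (⊥-combination a as a⊥b) ⟩
    e * 0# + 0#                         ≈⟨ trans (+-identityʳ _) (zeroʳ e) ⟩
    0#                                  ∎

  ⊥-axpy : ∀ {r} {x y} e {b : Vec V r} → x ⊥ b → y ⊥ b → x +ᴹ e *ₗ y ⊥ b
  ⊥-axpy e []      []      = []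
  ⊥-axpy {x = x} {y} e {v ∷ _} (p ∷ ps) (r ∷ rs) =
    trans (·-axpyˡ e x y v) (trans (+-cong p (trans (*-congˡ r) (zeroʳ e))) (+-identityʳ 0#)) ∷ ⊥-axpy e ps rs

  Span : ∀ {r} → Vec V r → V → Set _
  Span b v = ∃[ as ] v ≈ᴹ combination as b

  -- A positive certificate that `v` lies outside the span: the functional `a ·_` kills `b` but not
  -- `v`. Being data rather than a negation, it can be transported along an isometry and supplies
  -- vectors orthogonal to `b`.
  Dual : ∀ {r} → Vec V r → V → Set _
  Dual b v = ∃[ a ] a ⊥ b × a · v ≈ 1#

  ¬Span×Dual : ∀ {r} {b : Vec V r} {v} → Span b v → ¬ Dual b v
  ¬Span×Dual {b = b} {v} (as , v≈) (a , a⊥b , av≈1) = 1≉0 (begin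
    1#                   ≈⟨ av≈1 ⟨
    a · v                ≈⟨ ·-cong {a} (λ _ → refl) v≈ ⟩
    a · combination as b ≈⟨ ⊥-combination a as a⊥b ⟩
    0#                   ∎)

  -- Gaussian elimination carried by functionals. If `v` is redundant, a dual found for `u` over `b`
  -- kills `v` too. Otherwise `a₀` measures the `v`-component of `u`, which is subtracted before `b`
  -- is consulted again; a dual of the remainder is then corrected by a multiple of `a₀` so as to
  -- vanish on `v`.
  span? : ∀ {r} (b : Vec V r) u → Span b u ⊎ Dual b u
  span? [] u with Fin.any? (λ i → ¬? (u i ≟ 0#))
  ... | no  ∄i          = inj₁ ([] , λ i → decidable-stable (u i ≟ 0#) (λ uᵢ≉0 → ∄i (i , uᵢ≉0)))
  ... | yes (i , uᵢ≉0) with inverse uᵢ≉0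
  ...   | y , yuᵢ≈1 = inj₂ (y *ₗ basisVector i , [] ,
            trans (·-homoˡ y (basisVector i) u) (trans (*-congˡ (basisVector-· i u)) yuᵢ≈1))
  span? (v ∷ b) u with span? b v
  ... | inj₁ (as , v≈) with span? b u
  ...   | inj₁ (es , u≈)          = inj₁ (0# ∷ es , λ i →
            trans (u≈ i) (sym (trans (+-congʳ (zeroˡ (v i))) (+-identityˡ _))))
  ...   | inj₂ (a , a⊥b , au≈1)   = inj₂ (a ,
            trans (·-cong {a} (λ _ → refl) v≈) (⊥-combination a as a⊥b) ∷ a⊥b , au≈1)
  span? (v ∷ b) u | inj₂ (a₀ , a₀⊥b , a₀v≈1) with span? b (u +ᴹ (- (a₀ · u)) *ₗ v)
  ...   | inj₁ (es , u′≈) = inj₁ (a₀ · u ∷ es , λ i → begin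
            u i                                            ≈⟨ cancel (u i) (v i) ⟨
            (a₀ · u) * v i + (u i + - (a₀ · u) * v i)      ≈⟨ +-congˡ (u′≈ i) ⟩
            (a₀ · u) * v i + combination es b i            ∎)
          where
          cancel : ∀ s t → (a₀ · u) * t + (s + - (a₀ · u) * t) ≈ s
          cancel s t = begin
            (a₀ · u) * t + (s + - (a₀ · u) * t)
              ≈⟨ solve 4 (λ e n s t → e :* t :+ (s :+ n :* t) := s :+ (e :+ n) :* t) refl (a₀ · u) (- (a₀ · u)) s t ⟩
            s + (a₀ · u - a₀ · u) * t  ≈⟨ +-congˡ (*-congʳ (-‿inverseʳ (a₀ · u))) ⟩
            s + 0# * t                 ≈⟨ trans (+-congˡ (zeroˡ t)) (+-identityʳ s) ⟩
            s                          ∎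
  ...   | inj₂ (a , a⊥b , au′≈1) = inj₂ (a +ᴹ n *ₗ a₀ , orth ∷ ⊥-axpy n a⊥b a₀⊥b , unit)
          where
          n = - (a · v)
          orth : (a +ᴹ n *ₗ a₀) · v ≈ 0#
          orth = begin
            (a +ᴹ n *ₗ a₀) · v     ≈⟨ ·-axpyˡ n a a₀ v ⟩
            a · v + n * (a₀ · v)   ≈⟨ +-congˡ (trans (*-congˡ a₀v≈1) (*-identityʳ n)) ⟩
            a · v + n              ≈⟨ -‿inverseʳ (a · v) ⟩
            0#                     ∎
          -- The corrections a - (a · v) a₀ and u - (a₀ · u) v are adjoint to each other, so the
          -- value 1 on the remainder becomes the value on `u`.
          unit : (a +ᴹ n *ₗ a₀) · u ≈ 1#
          unit = begin
            (a +ᴹ n *ₗ a₀) · u                   ≈⟨ ·-axpyˡ n a a₀ u ⟩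
            a · u + - (a · v) * (a₀ · u)         ≈⟨ +-congˡ (-‿distribˡ-* (a · v) (a₀ · u)) ⟨
            a · u + - ((a · v) * (a₀ · u))       ≈⟨ +-congˡ (-‿cong (*-comm (a · v) (a₀ · u))) ⟩
            a · u + - ((a₀ · u) * (a · v))       ≈⟨ +-congˡ (-‿distribˡ-* (a₀ · u) (a · v)) ⟩
            a · u + - (a₀ · u) * (a · v)         ≈⟨ ·-axpyʳ (- (a₀ · u)) u v a ⟨
            a · (u +ᴹ (- (a₀ · u)) *ₗ v)         ≈⟨ au′≈1 ⟩
            1#                                   ∎

  -- The laws for zero and negation are homogeneity at the scalars 0 and - 1.
  isOrthogonal : ∀ (θ : V → V) →
    (∀ {x y} → x ≈ᴹ y → θ x ≈ᴹ θ y) →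
    (∀ x y → θ (x +ᴹ y) ≈ᴹ θ x +ᴹ θ y) →
    (∀ a x → θ (a *ₗ x) ≈ᴹ a *ₗ θ x) →
    (∀ x y → θ x · θ y ≈ x · y) → IsOrthogonal θ
  isOrthogonal θ cong +-homo *-homo ·-pres = record
    { isLinear = record
      { +ᴹ-isGroupHomomorphism = record
        { isMonoidHomomorphism = record
          { isMagmaHomomorphism = record
            { isRelHomomorphism = record { cong = λ {x} {y} → cong {x} {y} }
            ; homo = +-homo }
          ; ε-homo = λ i → begin
              θ 0ᴹ i          ≈⟨ cong {0ᴹ} {0# *ₗ 0ᴹ} (λ _ → sym (zeroˡ 0#)) i ⟩
              θ (0# *ₗ 0ᴹ) i  ≈⟨ *-homo 0# 0ᴹ i ⟩
              0# * θ 0ᴹ i     ≈⟨ zeroˡ _ ⟩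
              0#              ∎ }
        ; ⁻¹-homo = λ x i → begin
            θ (-ᴹ x) i          ≈⟨ cong { -ᴹ x} {(- 1#) *ₗ x} (λ j → sym (-1*x≈-x (x j))) i ⟩
            θ ((- 1#) *ₗ x) i   ≈⟨ *-homo (- 1#) x i ⟩
            - 1# * θ x i        ≈⟨ -1*x≈-x (θ x i) ⟩
            - θ x i             ∎ }
      ; *ₗ-homo = *-homo }
    ; ·-preserving = ·-pres }

  module Orthogonal {θ : V → V} (orthogonal : IsOrthogonal θ) where
    open IsOrthogonal orthogonal public
    open IsLeftModuleHomomorphism isLinear public
      using (+ᴹ-homo; *ₗ-homo; 0ᴹ-homo; -ᴹ-homo) renaming (⟦⟧-cong to cong)

  id-orthogonal : IsOrthogonal (λ v → v)
  id-orthogonal = isOrthogonal _ (λ e → e) (λ _ _ _ → refl) (λ _ _ _ → refl) (λ _ _ → refl)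

  ∘-orthogonal : ∀ {θ φ} → IsOrthogonal θ → IsOrthogonal φ → IsOrthogonal (θ ∘ φ)
  ∘-orthogonal {θ} {φ} Θ Φ = isOrthogonal (θ ∘ φ)
    (λ {x} {y} x≈y → Θ.cong {φ x} {φ y} (Φ.cong {x} {y} x≈y))
    (λ x y i → trans (Θ.cong {φ (x +ᴹ y)} {φ x +ᴹ φ y} (Φ.+ᴹ-homo x y) i) (Θ.+ᴹ-homo (φ x) (φ y) i))
    (λ a x i → trans (Θ.cong {φ (a *ₗ x)} {a *ₗ φ x} (Φ.*ₗ-homo a x) i) (Θ.*ₗ-homo a (φ x) i))
    (λ x y → trans (Θ.·-preserving (φ x) (φ y)) (Φ.·-preserving x y))
    where
    module Θ = Orthogonal Θ
    module Φ = Orthogonal Φ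

  -- With x = w - u this maps u to w as soon as f u ≈ 1# and g u ≈ 0#.  Both
  -- kinds of isometry needed for Witt's theorem have this shape: the reflection
  -- along x (B = C = 0) if x is anisotropic, and maps adding to v a vector of
  -- the plane of x and a suitable y if x is isotropic.
  module Transformation (x y : V) (A B C : Carrier) where

    f g : V → Carrier
    f v = A * (v · x) + B * (v · y)
    g v = C * (v · x)

    φ : V → V
    φ v = v +ᴹ f v *ₗ x +ᴹ g v *ₗ y

    φ-cong : ∀ {v w} → v ≈ᴹ w → φ v ≈ᴹ φ w
    φ-cong {v} {w} v≈w i = +-cong (+-cong (v≈w i) (*-congʳ (+-cong (*-congˡ vx) (*-congˡ vy)))) (*-congʳ (*-congˡ vx))
      where
      vx = ·-cong {v} {w} {x} v≈w (λ _ → refl)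
      vy = ·-cong {v} {w} {y} v≈w (λ _ → refl)

    φ-+-homo : ∀ v w → φ (v +ᴹ w) ≈ᴹ φ v +ᴹ φ w
    φ-+-homo v w i = begin
      v i + w i + (A * ((v +ᴹ w) · x) + B * ((v +ᴹ w) · y)) * x i + C * ((v +ᴹ w) · x) * y i
        ≈⟨ +-cong (+-congˡ (*-congʳ (+-cong (*-congˡ (·-distribʳ x v w)) (*-congˡ (·-distribʳ y v w)))))
                  (*-congʳ (*-congˡ (·-distribʳ x v w))) ⟩
      v i + w i + (A * (v · x + w · x) + B * (v · y + w · y)) * x i + C * (v · x + w · x) * y i
        ≈⟨ solve 11 (λ vᵢ wᵢ xᵢ yᵢ A B C vx vy wx wy →
             vᵢ :+ wᵢ :+ (A :* (vx :+ wx) :+ B :* (vy :+ wy)) :* xᵢ :+ C :* (vx :+ wx) :* yᵢ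
             := (vᵢ :+ (A :* vx :+ B :* vy) :* xᵢ :+ C :* vx :* yᵢ)
                :+ (wᵢ :+ (A :* wx :+ B :* wy) :* xᵢ :+ C :* wx :* yᵢ))
           refl (v i) (w i) (x i) (y i) A B C (v · x) (v · y) (w · x) (w · y) ⟩
      φ v i + φ w i ∎

    φ-*-homo : ∀ e v → φ (e *ₗ v) ≈ᴹ e *ₗ φ v
    φ-*-homo e v i = begin
      e * v i + (A * ((e *ₗ v) · x) + B * ((e *ₗ v) · y)) * x i + C * ((e *ₗ v) · x) * y i
        ≈⟨ +-cong (+-congˡ (*-congʳ (+-cong (*-congˡ (·-homoˡ e v x)) (*-congˡ (·-homoˡ e v y)))))
                  (*-congʳ (*-congˡ (·-homoˡ e v x))) ⟩
      e * v i + (A * (e * (v · x)) + B * (e * (v · y))) * x i + C * (e * (v · x)) * y i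
        ≈⟨ solve 9 (λ e vᵢ xᵢ yᵢ A B C vx vy →
             e :* vᵢ :+ (A :* (e :* vx) :+ B :* (e :* vy)) :* xᵢ :+ C :* (e :* vx) :* yᵢ
             := e :* (vᵢ :+ (A :* vx :+ B :* vy) :* xᵢ :+ C :* vx :* yᵢ))
           refl e (v i) (x i) (y i) A B C (v · x) (v · y) ⟩
      e * φ v i ∎

    φ-·ʳ : ∀ z v → z · φ v ≈ z · v + f v * (z · x) + g v * (z · y)
    φ-·ʳ z v = trans (·-axpyʳ (g v) (v +ᴹ f v *ₗ x) y z) (+-congʳ (·-axpyʳ (f v) v x z))

    φ-· : ∀ v w → φ v · φ w ≈
      (v · w + f w * (v · x) + g w * (v · y))
        + f v * (w · x + f w * (x · x) + g w * (x · y))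
        + g v * (w · y + f w * (x · y) + g w * (y · y))
    φ-· v w = begin
      φ v · φ w
        ≈⟨ ·-axpyˡ (g v) (v +ᴹ f v *ₗ x) y (φ w) ⟩
      (v +ᴹ f v *ₗ x) · φ w + g v * (y · φ w)
        ≈⟨ +-congʳ (·-axpyˡ (f v) v x (φ w)) ⟩
      v · φ w + f v * (x · φ w) + g v * (y · φ w)
        ≈⟨ +-cong (+-cong (φ-·ʳ v w) (*-congˡ (trans (φ-·ʳ x w) (+-congʳ (+-congʳ (·-comm x w))))))
                  (*-congˡ (trans (φ-·ʳ y w) (+-congʳ (+-cong (·-comm y w) (*-congˡ (·-comm y x)))))) ⟩
      _ ∎

    -- The hypotheses are the coefficients of (v · x)(w · x), of (v · x)(w · y) + (v · y)(w · x) and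
    -- of (v · y)(w · y) in the expansion of `φ v · φ w` minus `v · w`.
    φ-orthogonal :
      (A + A) + A * A * (x · x) + (A + A) * C * (x · y) + C * C * (y · y) ≈ 0# →
      B + C + A * B * (x · x) + B * C * (x · y) ≈ 0# →
      B * B * (x · x) ≈ 0# → IsOrthogonal φ
    φ-orthogonal K₁≈0 K₂≈0 K₃≈0 =
      isOrthogonal φ φ-cong φ-+-homo φ-*-homo λ v w → begin
        φ v · φ w ≈⟨ φ-· v w ⟩
        _ ≈⟨ solve 11 (λ vw vx vy wx wy A B C p r s →
               let fv = A :* vx :+ B :* vy ; fw = A :* wx :+ B :* wy
                   gv = C :* vx ; gw = C :* wx in
               (vw :+ fw :* vx :+ gw :* vy) :+ fv :* (wx :+ fw :* p :+ gw :* r)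
                 :+ gv :* (wy :+ fw :* r :+ gw :* s)
               := vw :+ (((A :+ A) :+ A :* A :* p :+ (A :+ A) :* C :* r :+ C :* C :* s) :* (vx :* wx)
                    :+ (B :+ C :+ A :* B :* p :+ B :* C :* r) :* (vx :* wy :+ vy :* wx)
                    :+ B :* B :* p :* (vy :* wy)))
             refl (v · w) (v · x) (v · y) (w · x) (w · y) A B C (x · x) (x · y) (y · y) ⟩
        _ ≈⟨ +-congˡ (+-cong (+-cong (vanish K₁≈0) (vanish K₂≈0)) (vanish K₃≈0)) ⟩
        v · w + (0# + 0# + 0#) ≈⟨ solve 1 (λ t → t :+ (con 0 :+ con 0 :+ con 0) := t) refl (v · w) ⟩
        v · w ∎
      where
      vanish : ∀ {K t} → K ≈ 0# → K * t ≈ 0#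
      vanish K≈0 = trans (*-congʳ K≈0) (zeroˡ _)

    φ-fixes : ∀ {v} → v · x ≈ 0# → v · y ≈ 0# → φ v ≈ᴹ v
    φ-fixes {v} vx≈0 vy≈0 i = begin
      v i + (A * (v · x) + B * (v · y)) * x i + C * (v · x) * y i
        ≈⟨ +-cong (+-congˡ (*-congʳ (+-cong (*-congˡ vx≈0) (*-congˡ vy≈0)))) (*-congʳ (*-congˡ vx≈0)) ⟩
      v i + (A * 0# + B * 0#) * x i + C * 0# * y i
        ≈⟨ solve 6 (λ t A B C x y → t :+ (A :* con 0 :+ B :* con 0) :* x :+ C :* con 0 :* y := t)
             refl (v i) A B C (x i) (y i) ⟩
      v i ∎

-- Witt's theorem for one additional vector

module Witt {c ℓ₁ ℓ₂} (F : HeytingField c ℓ₁ ℓ₂) (q : ℕ)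
            (order : Configurations.FieldHasOrder F q) (d : ℕ)
            (2≉0 : OddCharacteristic F) where

  open FiniteField F q order
  open Configurations F
  open RawLeftModule (Space d) using (_≈ᴹ_; _+ᴹ_; _*ₗ_) renaming (Carrierᴹ to V)
  open LinearAlgebra F q order d
  open import Relation.Binary.Reasoning.Setoid setoid

  -- A vector space is not the union of two proper subspaces: if `a` kills `w` and `e` kills `u`,
  -- then a + e takes the value 1 on both.
  separating : ∀ {r} {b : Vec V r} {u w} → Dual b u → Dual b w →
               ∃[ y ] y ⊥ b × y · u ≉ 0# × y · w ≉ 0#
  separating {u = u} {w} (a , a⊥b , au≈1) (e , e⊥b , ew≈1) with a · w ≟ 0# | e · u ≟ 0#
  ... | no aw≉0  | _        = a , a⊥b , (λ au≈0 → 1≉0 (trans (sym au≈1) au≈0)) , aw≉0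
  ... | yes _    | no eu≉0  = e , e⊥b , eu≉0 , (λ ew≈0 → 1≉0 (trans (sym ew≈1) ew≈0))
  ... | yes aw≈0 | yes eu≈0 = a +ᴹ 1# *ₗ e , ⊥-axpy 1# a⊥b e⊥b ,
    (λ eq → 1≉0 (trans (sym (unit u (trans (+-cong au≈1 (*-congˡ eu≈0)) (solve 0 (con 1 :+ con 1 :* con 0 := con 1) refl)))) eq)) ,
    (λ eq → 1≉0 (trans (sym (unit w (trans (+-cong aw≈0 (*-congˡ ew≈1)) (solve 0 (con 0 :+ con 1 :* con 1 := con 1) refl)))) eq))
    where
    unit : ∀ z → a · z + 1# * (e · z) ≈ 1# → (a +ᴹ 1# *ₗ e) · z ≈ 1#
    unit z = trans (·-axpyˡ 1# a e z)

  private
    -- The solver normalises over semirings, so negation enters it as multiplication by an opaque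
    -- atom; the identities below are arranged to leave a factor 1 + `-1#` or a product `-1# * -1#`
    -- to be evaluated by hand.
    -1# : Carrier
    -1# = - 1#

    1+-1≈0 : 1# + -1# ≈ 0#
    1+-1≈0 = -‿inverseʳ 1#

    -1*-1≈1 : -1# * -1# ≈ 1#
    -1*-1≈1 = trans (-1*x≈-x -1#) (-‿involutive 1#)

    vanish : ∀ {K t} → K ≈ 0# → K * t ≈ 0#
    vanish K≈0 = trans (*-congʳ K≈0) (zeroˡ _)

  module _ {n} {b : Vec V n} {u w : V} (wb≈ub : All (λ v → w · v ≈ u · v) b) (ww≈uu : w · w ≈ u · u) where

    private
      x : V
      x = w +ᴹ -1# *ₗ u

      x⊥b : x ⊥ b
      x⊥b = All.map (λ {v} e → begin
        x · v                   ≈⟨ ·-axpyˡ -1# w u v ⟩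
        w · v + -1# * (u · v)   ≈⟨ +-congʳ e ⟩
        u · v + -1# * (u · v)   ≈⟨ solve 2 (λ m t → t :+ m :* t := (con 1 :+ m) :* t) refl -1# (u · v) ⟩
        (1# + -1#) * (u · v) ≈⟨ vanish 1+-1≈0 ⟩
        0#                      ∎) wb≈ub

      -- The equation w · w = u · u with w = u + x substituted. It fixes the coefficient of the
      -- reflection, and for isotropic `x` it forces u · x = 0.
      xx+2ux≈0 : x · x + (u · x + u · x) ≈ 0#
      xx+2ux≈0 = begin
        x · x + (u · x + u · x)
          ≈⟨ +-congʳ (·-axpyˡ -1# w u x) ⟩
        w · x + -1# * (u · x) + (u · x + u · x)
          ≈⟨ +-cong (+-cong wx (*-congˡ ux)) (+-cong ux ux) ⟩
        _ ≈⟨ solve 3 (λ m uu uw →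
               (uu :+ m :* uw) :+ m :* (uw :+ m :* uu) :+ ((uw :+ m :* uu) :+ (uw :+ m :* uu))
               := (con 1 :+ m) :* ((con 1 :+ m) :* uu :+ uw :+ uw)) refl -1# (u · u) (u · w) ⟩
        _ ≈⟨ vanish 1+-1≈0 ⟩
        0# ∎
        where
        ux : u · x ≈ u · w + -1# * (u · u)
        ux = ·-axpyʳ -1# w u u
        wx : w · x ≈ u · u + -1# * (u · w)
        wx = trans (·-axpyʳ -1# w u w) (+-cong ww≈uu (*-congˡ (·-comm w u)))

      module _ (y : V) (A B C : Carrier) where
        open Transformation x y A B C

        moves : f u ≈ 1# → g u ≈ 0# → φ u ≈ᴹ w
        moves fu≈1 gu≈0 i = begin
          u i + f u * (w i + -1# * u i) + g u * y i ≈⟨ +-cong (+-congˡ (*-congʳ fu≈1)) (*-congʳ gu≈0) ⟩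
          u i + 1# * (w i + -1# * u i) + 0# * y i
            ≈⟨ solve 4 (λ m u w y → u :+ con 1 :* (w :+ m :* u) :+ con 0 :* y := w :+ (con 1 :+ m) :* u)
                 refl -1# (u i) (w i) (y i) ⟩
          _ ≈⟨ +-congˡ (vanish 1+-1≈0) ⟩
          w i + 0# ≈⟨ +-identityʳ (w i) ⟩
          w i ∎

        fixes : y ⊥ b → All (λ v → φ v ≈ᴹ v) b
        fixes y⊥b = All.map (λ {v} (xv , yv) → φ-fixes {v} (trans (·-comm v x) xv) (trans (·-comm v y) yv))
                            (All.zip (x⊥b , y⊥b))

      Extension : Set _
      Extension = ∃[ φ ] IsOrthogonal φ × All (λ v → φ v ≈ᴹ v) b × φ u ≈ᴹ w

      -- The classical map v - 2 (v · x) / (x · x) x, whence `A` = - 2 / (x · x). It adds exactly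
      -- `x` to `u` because 2 (u · x) = - (x · x). With `x` also as the second vector, orthogonality
      -- to `b` is again `x⊥b`.
      reflection : x · x ≉ 0# → Extension
      reflection p≉0 with inverse p≉0
      ... | p⁻¹ , p⁻¹p≈1 = _ ,
        Transformation.φ-orthogonal x x A 0# 0#
          (begin
            _ ≈⟨ solve 3 (λ m i p →
                   let A = m :* (i :+ i) in
                   (A :+ A) :+ A :* A :* p :+ (A :+ A) :* con 0 :* p :+ con 0 :* con 0 :* p
                   := A :* (con 1 :+ con 1 :+ m :* (i :* p :+ i :* p))) refl -1# p⁻¹ p ⟩
            A * (1# + 1# + -1# * (p⁻¹ * p + p⁻¹ * p))
              ≈⟨ *-congˡ (+-congˡ (*-congˡ (+-cong p⁻¹p≈1 p⁻¹p≈1))) ⟩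
            A * (1# + 1# + -1# * (1# + 1#))
              ≈⟨ solve 2 (λ A m → A :* (con 1 :+ con 1 :+ m :* (con 1 :+ con 1))
                                  := (con 1 :+ m) :* (A :+ A)) refl A -1# ⟩
            _ ≈⟨ vanish 1+-1≈0 ⟩
            0# ∎)
          (solve 2 (λ A p → con 0 :+ con 0 :+ A :* con 0 :* p :+ con 0 :* con 0 :* p := con 0) refl A p)
          (solve 1 (λ p → con 0 :* con 0 :* p := con 0) refl p) ,
        fixes x A 0# 0# x⊥b ,
        moves x A 0# 0# (begin
            A * ux + 0# * ux
              ≈⟨ solve 4 (λ m i p t → m :* (i :+ i) :* t :+ con 0 :* t := m :* i :* (t :+ t)) refl -1# p⁻¹ p ux ⟩
            -1# * p⁻¹ * (ux + ux)    ≈⟨ *-congˡ 2ux≈-p ⟩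
            -1# * p⁻¹ * (-1# * p)
              ≈⟨ solve 3 (λ m i p → m :* i :* (m :* p) := m :* m :* (i :* p)) refl -1# p⁻¹ p ⟩
            -1# * -1# * (p⁻¹ * p)    ≈⟨ *-cong -1*-1≈1 p⁻¹p≈1 ⟩
            1# * 1#                  ≈⟨ *-identityˡ 1# ⟩
            1#                       ∎)
          (zeroˡ ux)
        where
        p = x · x
        ux = u · x
        A = -1# * (p⁻¹ + p⁻¹)
        2ux≈-p : ux + ux ≈ -1# * p
        2ux≈-p = +-cancelˡ {p} (trans xx+2ux≈0 (sym (trans
          (solve 2 (λ m p → p :+ m :* p := (con 1 :+ m) :* p) refl -1# p)
          (vanish 1+-1≈0))))

      -- For x · x ≈ 0#, preserving the form means 2A(1 + Cr) + C²s ≈ 0# and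
      -- B(1 + Cr) + C ≈ 0#, where r = x · y and s = y · y; mapping u to w asks
      -- for B(y · u) ≈ 1#.  As r ≈ y · w - y · u, this determines A, B and C
      -- whenever y · u and y · w are nonzero.
      isotropic : Dual b u → Dual b w → x · x ≈ 0# → Extension
      isotropic u∉b w∉b p≈0 with separating u∉b w∉b
      ... | y , y⊥b , yu≉0 , yw≉0 with inverse yu≉0 | inverse yw≉0 | inverse 2≉0
      ...   | β⁻¹ , β⁻¹β≈1 | γ⁻¹ , γ⁻¹γ≈1 | ½ , ½*2≈1 = _ ,
        Transformation.φ-orthogonal x y A β⁻¹ C
          (begin
            A + A + A * A * p + (A + A) * C * r + C * C * s
              ≈⟨ +-congʳ (+-congʳ (+-congˡ (*-congˡ p≈0))) ⟩
            A + A + A * A * 0# + (A + A) * C * r + C * C * s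
              ≈⟨ solve 4 (λ A C r s → A :+ A :+ A :* A :* con 0 :+ (A :+ A) :* C :* r :+ C :* C :* s
                    := (A :+ A) :* (con 1 :+ C :* r) :+ C :* C :* s) refl A C r s ⟩
            (A + A) * (1# + C * r) + C * C * s
              ≈⟨ +-congʳ (*-congˡ 1+Cr) ⟩
            (A + A) * (γ⁻¹ * β) + C * C * s
              ≈⟨ solve 6 (λ m h β⁻¹ β γ⁻¹ s →
                   let A = m :* h :* s :* β⁻¹ :* γ⁻¹ ; C = m :* γ⁻¹ in
                   (A :+ A) :* (γ⁻¹ :* β) :+ C :* C :* s
                   := m :* (γ⁻¹ :* γ⁻¹ :* s) :* ((h :* (con 1 :+ con 1)) :* (β⁻¹ :* β) :+ m))
                 refl -1# ½ β⁻¹ β γ⁻¹ s ⟩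
            -1# * (γ⁻¹ * γ⁻¹ * s) * (½ * (1# + 1#) * (β⁻¹ * β) + -1#)
              ≈⟨ *-congˡ (+-congʳ (*-cong ½*2≈1 β⁻¹β≈1)) ⟩
            -1# * (γ⁻¹ * γ⁻¹ * s) * (1# * 1# + -1#)
              ≈⟨ *-congˡ (trans (+-congʳ (*-identityˡ 1#)) 1+-1≈0) ⟩
            _ ≈⟨ zeroʳ _ ⟩
            0# ∎)
          (begin
            β⁻¹ + C + A * β⁻¹ * p + β⁻¹ * C * r
              ≈⟨ +-congʳ (+-congˡ (*-congˡ p≈0)) ⟩
            β⁻¹ + C + A * β⁻¹ * 0# + β⁻¹ * C * r
              ≈⟨ solve 4 (λ A B C r → B :+ C :+ A :* B :* con 0 :+ B :* C :* r := B :* (con 1 :+ C :* r) :+ C)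
                   refl A β⁻¹ C r ⟩
            β⁻¹ * (1# + C * r) + C
              ≈⟨ +-congʳ (*-congˡ 1+Cr) ⟩
            β⁻¹ * (γ⁻¹ * β) + -1# * γ⁻¹
              ≈⟨ solve 4 (λ m β⁻¹ β γ⁻¹ → β⁻¹ :* (γ⁻¹ :* β) :+ m :* γ⁻¹ := (β⁻¹ :* β :+ m) :* γ⁻¹)
                   refl -1# β⁻¹ β γ⁻¹ ⟩
            (β⁻¹ * β + -1#) * γ⁻¹ ≈⟨ vanish (trans (+-congʳ β⁻¹β≈1) 1+-1≈0) ⟩
            0# ∎)
          (trans (*-congˡ p≈0) (zeroʳ _)) ,
        fixes y A β⁻¹ C y⊥b ,
        moves y A β⁻¹ C (begin
            A * (u · x) + β⁻¹ * (u · y)  ≈⟨ +-cong (*-congˡ ux≈0) (*-congˡ (·-comm u y)) ⟩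
            A * 0# + β⁻¹ * β             ≈⟨ +-cong (zeroʳ A) β⁻¹β≈1 ⟩
            0# + 1#                      ≈⟨ +-identityˡ 1# ⟩
            1#                           ∎)
          (trans (*-congˡ ux≈0) (zeroʳ C))
        where
        p = x · x
        β = y · u
        γ = y · w
        r = x · y
        s = y · y
        -- With `C` = - 1 / γ and r = γ - β one has 1 + C r = β / γ, so the first condition reads 2
        -- A β / γ + s / γ² = 0; this is its solution.
        A = -1# * ½ * s * β⁻¹ * γ⁻¹
        C = -1# * γ⁻¹
        ux≈0 : u · x ≈ 0#
        ux≈0 = *-cancelˡ 2≉0 (begin
          (1# + 1#) * (u · x)        ≈⟨ trans (distribʳ _ 1# 1#) (+-cong (*-identityˡ _) (*-identityˡ _)) ⟩
          u · x + u · x              ≈⟨ +-identityˡ _ ⟨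
          0# + (u · x + u · x)       ≈⟨ +-congʳ p≈0 ⟨
          p + (u · x + u · x)        ≈⟨ xx+2ux≈0 ⟩
          0#                         ≈⟨ zeroʳ _ ⟨
          (1# + 1#) * 0#             ∎)
        1+Cr : 1# + C * r ≈ γ⁻¹ * β
        1+Cr = begin
          1# + -1# * γ⁻¹ * r
            ≈⟨ +-congˡ (*-congˡ (trans (·-comm x y) (·-axpyʳ -1# w u y))) ⟩
          1# + -1# * γ⁻¹ * (γ + -1# * β)
            ≈⟨ +-congˡ (solve 4 (λ m γ⁻¹ γ β → m :* γ⁻¹ :* (γ :+ m :* β) := m :* (γ⁻¹ :* γ) :+ m :* m :* (γ⁻¹ :* β))
                 refl -1# γ⁻¹ γ β) ⟩
          1# + (-1# * (γ⁻¹ * γ) + -1# * -1# * (γ⁻¹ * β))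
            ≈⟨ +-congˡ (+-cong (trans (*-congˡ γ⁻¹γ≈1) (*-identityʳ -1#)) (trans (*-congʳ -1*-1≈1) (*-identityˡ _))) ⟩
          1# + (-1# + γ⁻¹ * β)  ≈⟨ +-assoc 1# -1# _ ⟨
          1# + -1# + γ⁻¹ * β    ≈⟨ +-congʳ 1+-1≈0 ⟩
          0# + γ⁻¹ * β          ≈⟨ +-identityˡ _ ⟩
          γ⁻¹ * β               ∎

    -- The hypotheses say that fixing `b` and sending `u` to `w` preserves all products. The
    -- difference `x` is then orthogonal to `b`, so isometries built from it and another vector
    -- orthogonal to `b` leave `b` alone.
    extend : Dual b u → Dual b w → ∃[ φ ] IsOrthogonal φ × All (λ v → φ v ≈ᴹ v) b × φ u ≈ᴹ w
    extend u∉b w∉b with x · x ≟ 0#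
    ... | yes p≈0 = isotropic u∉b w∉b p≈0
    ... | no  p≉0 = reflection p≉0

-- Counting finite types and codes

↔-injective : ∀ {a b} {A : Set a} {B : Set b} (i : A ↔ B) → Injective _≡_ _≡_ (Inverse.to i)
↔-injective i = Injection.injective (Inverse⇒Injection i)

Vec↔Fin : ∀ {a} {A : Set a} {m} → A ↔ Fin m → ∀ n → Vec A n ↔ Fin (m ℕ.^ n)
Vec↔Fin A↔m zero    = mk↔ₛ′ (λ _ → zero) (λ _ → []) (λ { zero → ≡.refl }) (λ { [] → ≡.refl })
Vec↔Fin A↔m (suc n) = ↔-trans
  (mk↔ₛ′ Vec.uncons (uncurry _∷_) (λ _ → ≡.refl) (λ { (_ ∷ _) → ≡.refl }))
  (↔-trans (A↔m ×-↔ Vec↔Fin A↔m n) (↔-sym Fin.*↔×))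

finite-injection⇒≤ : ∀ {a b} {A : Set a} {B : Set b} {m n} → A ↔ Fin m → B ↔ Fin n →
                     {f : A → B} → Injective _≡_ _≡_ f → m ℕ.≤ n
finite-injection⇒≤ A↔m B↔n {f} f-inj =
  Fin.injective⇒≤ {f = Inverse.to B↔n ∘ f ∘ Inverse.from A↔m}
    (↔-injective (↔-sym A↔m) ∘ f-inj ∘ ↔-injective B↔n)

module _ (q : ℕ) where

  -- n vectors are still to be read, r of those already read form a basis of
  -- their span, and s = d − r.  A vector of the span is recorded by its
  -- coordinates, any other one by its products with the basis and itself.
  Code : ℕ → ℕ → ℕ → Set
  Code zero    r s       = ⊤
  Code (suc n) r zero    = Vec (Fin q) r × Code n r zero
  Code (suc n) r (suc s) =
    (Vec (Fin q) r × Code n r (suc s)) ⊎ (Vec (Fin q) (suc r) × Code n (suc r) s)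

  codes : ℕ → ℕ → ℕ → ℕ
  codes zero    r s       = 1
  codes (suc n) r zero    = q ℕ.^ r ℕ.* codes n r zero
  codes (suc n) r (suc s) = q ℕ.^ r ℕ.* codes n r (suc s) ℕ.+ q ℕ.^ suc r ℕ.* codes n (suc r) s

  Code↔Fin : ∀ n r s → Code n r s ↔ Fin (codes n r s)
  Code↔Fin zero    r s       = ↔-sym Fin.1↔⊤
  Code↔Fin (suc n) r zero    = ↔-trans (Vec↔Fin ↔-refl r ×-↔ Code↔Fin n r zero) (↔-sym Fin.*↔×)
  Code↔Fin (suc n) r (suc s) = ↔-trans
    (↔-trans (Vec↔Fin ↔-refl r ×-↔ Code↔Fin n r (suc s)) (↔-sym Fin.*↔×) ⊎-↔
     ↔-trans (Vec↔Fin ↔-refl (suc r) ×-↔ Code↔Fin n (suc r) s) (↔-sym Fin.*↔×))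
    (↔-sym Fin.+↔⊎)

-- Codes as a complete invariant of the orthogonal group

module Classification {c ℓ₁ ℓ₂} (F : HeytingField c ℓ₁ ℓ₂) (q : ℕ)
                      (order : Configurations.FieldHasOrder F q) (d : ℕ)
                      (2≉0 : OddCharacteristic F) where

  open FiniteField F q order
  open Configurations F
  open RawLeftModule (Space d) using (_≈ᴹ_; _+ᴹ_; _*ₗ_) renaming (Carrierᴹ to V)
  open LinearAlgebra F q order d
  open Witt F q order d 2≉0
  open import Relation.Binary.Reasoning.Setoid setoid

  indices : ∀ {r} → Vec Carrier r → Vec (Fin q) r
  indices = Vec.map index

  indices-cong : ∀ {r} {as es : Vec Carrier r} → Pointwise _≈_ as es → indices as ≡ indices es
  indices-cong []       = ≡.refl
  indices-cong (p ∷ ps) = ≡.cong₂ _∷_ (index-cong p) (indices-cong ps)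

  indices-injective : ∀ {r} (as es : Vec Carrier r) → indices as ≡ indices es → Pointwise _≈_ as es
  indices-injective []       []       eq = []
  indices-injective (a ∷ as) (e ∷ es) eq with Vec.∷-injective eq
  ... | p , ps = index-injective p ∷ indices-injective as es ps

  data Independent : ∀ {r} → Vec V r → Set (c ⊔ ℓ₁) where
    []  : Independent []
    _∷_ : ∀ {r} {v} {b : Vec V r} → Dual b v → Independent b → Independent (v ∷ b)

  -- The dual of the newest vector, which stands at the head, kills the older ones and thus reads
  -- off the first coordinate; the rest follows after cancelling that term.
  combination-injective : ∀ {r} {b : Vec V r} → Independent b → ∀ as es →
    combination as b ≈ᴹ combination es b → Pointwise _≈_ as es
  combination-injective []                                  []       []       eq = []
  combination-injective {b = v ∷ b} ((x , x⊥b , xv≈1) ∷ indep) (a ∷ as) (e ∷ es) eq =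
    a≈e ∷ combination-injective indep as es λ i →
      +-cancelˡ (trans (eq i) (+-congʳ (*-congʳ (sym a≈e))))
    where
    head : ∀ a as → x · combination (a ∷ as) (v ∷ b) ≈ a
    head a as = begin
      x · (a *ₗ v +ᴹ combination as b)    ≈⟨ ·-distribˡ x (a *ₗ v) (combination as b) ⟩
      x · (a *ₗ v) + x · combination as b
        ≈⟨ +-cong (trans (·-homoʳ a x v) (*-congˡ xv≈1)) (⊥-combination x as x⊥b) ⟩
      a * 1# + 0#                         ≈⟨ trans (+-identityʳ _) (*-identityʳ a) ⟩
      a                                   ∎
    a≈e : a ≈ e
    a≈e = trans (sym (head a as)) (trans (·-cong {x} (λ _ → refl) eq) (head e es))

  -- Counting replaces an exchange argument: the q ^ r combinations are pairwise distinct among only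
  -- q ^ d vectors.
  independent⇒≤ : ∀ {r} {b : Vec V r} → Independent b → r ℕ.≤ d
  independent⇒≤ {r} {b} indep = ℕ.≮⇒≥ λ d<r → ℕ.<⇒≱ (ℕ.^-monoʳ-< q 1<q d<r)
    (finite-injection⇒≤ (Vec↔Fin ↔-refl r) (Vec↔Fin ↔-refl d) {f} f-injective)
    where
    f : Vec (Fin q) r → Vec (Fin q) d
    f is = Vec.tabulate (index ∘ combination (Vec.map element is) b)
    elements-injective : ∀ {r} (is js : Vec (Fin q) r) →
                         Pointwise _≈_ (Vec.map element is) (Vec.map element js) → is ≡ js
    elements-injective []       []       []       = ≡.refl
    elements-injective (_ ∷ is) (_ ∷ js) (p ∷ ps) =
      ≡.cong₂ _∷_ (element-injective p) (elements-injective is js ps)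
    f-injective : Injective _≡_ _≡_ f
    f-injective {is} {js} eq = elements-injective is js (combination-injective indep _ _ λ i →
      index-injective (≡.trans (≡.sym (Vec.lookup∘tabulate _ i))
        (≡.trans (≡.cong (λ v → Vec.lookup v i) eq) (Vec.lookup∘tabulate _ i))))

  products : ∀ {r} → V → Vec V r → Vec Carrier r
  products v = Vec.map (v ·_)

  -- A vector outside the span of d independent ones does not exist; for it
  -- the junk coordinates 0 are recorded.
  code : ∀ n {r} s (b : Vec V r) (xs : Fin n → V) → Code q n r s
  codeStep : ∀ n {r} s (b : Vec V r) v (xs : Fin n → V) → Span b v ⊎ Dual b v → Code q (suc n) r s
  code zero    s b xs = tt
  code (suc n) s b xs = codeStep n s b (xs zero) (xs ∘ suc) (span? b (xs zero))
  codeStep n zero    b v xs (inj₁ (as , _)) = indices as , code n zero b xs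
  codeStep n zero    b v xs (inj₂ _)        = Vec.replicate _ (index 0#) , code n zero b xs
  codeStep n (suc s) b v xs (inj₁ (as , _)) = inj₁ (indices as , code n (suc s) b xs)
  codeStep n (suc s) b v xs (inj₂ _)        = inj₂ (indices (products v (v ∷ b)) , code n s (v ∷ b) xs)

  Maps : (V → V) → ∀ {r} → Vec V r → Vec V r → Set _
  Maps θ = Pointwise (λ v v′ → θ v ≈ᴹ v′)

  module Image {θ : V → V} (orthogonal : IsOrthogonal θ) where
    open Orthogonal orthogonal

    combination-image : ∀ {r} {b b′ : Vec V r} (as : Vec Carrier r) → Maps θ b b′ →
                        θ (combination as b) ≈ᴹ combination as b′
    combination-image []       []       i = 0ᴹ-homo i
    combination-image {b = v ∷ b} {v′ ∷ b′} (a ∷ as) (e ∷ es) i = begin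
      θ (a *ₗ v +ᴹ combination as b) i     ≈⟨ +ᴹ-homo (a *ₗ v) (combination as b) i ⟩
      θ (a *ₗ v) i + θ (combination as b) i
        ≈⟨ +-cong (trans (*ₗ-homo a v i) (*-congˡ (e i))) (combination-image as es i) ⟩
      a * v′ i + combination as b′ i       ∎

    span-image : ∀ {r} {b b′ : Vec V r} {v v′} → Maps θ b b′ → θ v ≈ᴹ v′ →
                 ((as , _) : Span b v) → v′ ≈ᴹ combination as b′
    span-image {b = b} {v = v} es e (as , v≈) i =
      trans (sym (e i)) (trans (cong {v} {combination as b} v≈ i) (combination-image as es i))

    ·-image : ∀ {v v′ w w′} → θ v ≈ᴹ v′ → θ w ≈ᴹ w′ → v · w ≈ v′ · w′
    ·-image {v} {v′} {w} {w′} p r = trans (sym (·-preserving v w)) (·-cong {θ v} {v′} {θ w} {w′} p r)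

    products-image : ∀ {r} {b b′ : Vec V r} {v v′} → Maps θ b b′ → θ v ≈ᴹ v′ →
                     Pointwise _≈_ (products v b) (products v′ b′)
    products-image []       p = []
    products-image {v = v} {v′} (e ∷ es) p = ·-image {v} p e ∷ products-image {v = v} es p

    dual-image : ∀ {r} {b b′ : Vec V r} {v v′} → Maps θ b b′ → θ v ≈ᴹ v′ → Dual b v → Dual b′ v′
    dual-image {b′ = b′} {v} es p (a , a⊥b , av≈1) =
      θ a , ⊥-image es a⊥b , trans (sym (·-image {a} {w = v} (λ _ → refl) p)) av≈1
      where
      ⊥-image : ∀ {r} {b b′ : Vec V r} → Maps θ b b′ → a ⊥ b → θ a ⊥ b′
      ⊥-image []       []       = []
      ⊥-image {b = w ∷ _} (e ∷ es) (p ∷ ps) = trans (sym (·-image {a} {w = w} (λ _ → refl) e)) p ∷ ⊥-image es ps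

    independent-image : ∀ {r} {b b′ : Vec V r} → Maps θ b b′ → Independent b → Independent b′
    independent-image []       []              = []
    independent-image {b = v ∷ _} (e ∷ es) (dual ∷ indep) =
      dual-image {v = v} es e dual ∷ independent-image es indep

  -- Excludes the junk branch of `code`: with nothing left to find, one more dual would make d + 1
  -- vectors independent.
  no-further : ∀ {r} {b : Vec V r} {v} {a} {A : Set a} → r ℕ.+ 0 ≡ d → Independent b → Dual b v → A
  no-further {r} r+0≡d indep dual = contradiction
    (ℕ.≤-trans (independent⇒≤ (dual ∷ indep)) (ℕ.≤-reflexive (≡.trans (≡.sym r+0≡d) (ℕ.+-identityʳ r))))
    ℕ.1+n≰n

  -- Isometries carry spans to spans and duals to duals, so both readings take the same branch each
  -- time. The two calls of `span?` find their coordinates separately; uniqueness of coordinates in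
  -- an independent tuple makes them agree.
  code-invariant : ∀ n {r} s {b b′ : Vec V r} {xs ys : Fin n → V} {θ} → IsOrthogonal θ →
    Independent b → r ℕ.+ s ≡ d → Maps θ b b′ → (∀ i → θ (xs i) ≈ᴹ ys i) →
    code n s b xs ≡ code n s b′ ys
  code-invariant zero    s Θ indep dim bs xys = ≡.refl
  code-invariant (suc n) {r} s {b} {b′} {xs} {ys} {θ} Θ indep dim bs xys =
    step s dim (span? b (xs zero)) (span? b′ (ys zero))
    where
    open Image Θ
    x = xs zero
    y = ys zero
    indep′ = independent-image bs indep
    step : ∀ s → r ℕ.+ s ≡ d → (p : Span b x ⊎ Dual b x) (p′ : Span b′ y ⊎ Dual b′ y) →
           codeStep n s b x (xs ∘ suc) p ≡ codeStep n s b′ y (ys ∘ suc) p′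
    coordinates : ((as , _) : Span b x) ((es , _) : Span b′ y) → indices as ≡ indices es
    coordinates p@(as , _) (es , y≈) = indices-cong (combination-injective indep′ as es λ i →
      trans (sym (span-image {v = x} bs (xys zero) p i)) (y≈ i))
    step s       dim (inj₁ (as , x≈)) (inj₂ dual) =
      contradiction dual (¬Span×Dual (as , span-image {v = x} bs (xys zero) (as , x≈)))
    step s       dim (inj₂ dual) (inj₁ span) =
      contradiction (dual-image {v = x} bs (xys zero) dual) (¬Span×Dual span)
    step zero    dim (inj₁ p) (inj₁ p′) =
      ≡.cong₂ _,_ (coordinates p p′) (code-invariant n zero Θ indep dim bs (xys ∘ suc))
    step (suc s) dim (inj₁ p) (inj₁ p′) = ≡.cong inj₁
      (≡.cong₂ _,_ (coordinates p p′) (code-invariant n (suc s) Θ indep dim bs (xys ∘ suc)))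
    step zero    dim (inj₂ dual) (inj₂ _) = no-further dim indep dual
    step (suc s) dim (inj₂ dual) (inj₂ _) = ≡.cong inj₂ (≡.cong₂ _,_
      (indices-cong (products-image {v = x} (xys zero ∷ bs) (xys zero)))
      (code-invariant n s Θ (dual ∷ indep) (≡.trans (≡.sym (ℕ.+-suc r s)) dim) (xys zero ∷ bs) (xys ∘ suc)))

  -- `θ` is only known to match the bases collected so far and is corrected whenever they grow. A
  -- dependent vector is matched after the recursive call, by linearity of the final isometry, since
  -- equal codes give it equal coordinates in both bases.
  code-complete : ∀ n {r} s {b b′ : Vec V r} {xs ys : Fin n → V} {θ} → IsOrthogonal θ →
    Independent b → r ℕ.+ s ≡ d → Maps θ b b′ → code n s b xs ≡ code n s b′ ys →
    ∃[ φ ] IsOrthogonal φ × Maps φ b b′ × (∀ i → φ (xs i) ≈ᴹ ys i)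
  code-complete zero    s {θ = θ} Θ indep dim bs eq = θ , Θ , bs , λ ()
  code-complete (suc n) {r} s {b} {b′} {xs} {ys} {θ} Θ indep dim bs eq =
    step s dim (span? b (xs zero)) (span? b′ (ys zero)) eq
    where
    open Image Θ
    x = xs zero
    y = ys zero
    Extension : Set _
    Extension = ∃[ φ ] IsOrthogonal φ × Maps φ b b′ × (∀ i → φ (xs i) ≈ᴹ ys i)
    spanned : ((as , _) : Span b x) ((es , _) : Span b′ y) → indices as ≡ indices es →
      (∃[ φ ] IsOrthogonal φ × Maps φ b b′ × (∀ i → φ (xs (suc i)) ≈ᴹ ys (suc i))) → Extension
    spanned (as , x≈) (es , y≈) eq (φ , Φ , bs , xys) = φ , Φ , bs , λ where
      zero i → trans (Orthogonal.cong Φ {x} {combination as b} x≈ i)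
        (trans (Image.combination-image Φ as bs i)
        (trans (combination-cong b′ (indices-injective as es eq) i) (sym (y≈ i))))
      (suc j) → xys j
    -- Equal records give `θ x` and `y` the same norm (the head of the products) and the same
    -- products with `b′`. `extend` then moves one to the other fixing `b′`, so its composite with
    -- `θ` still maps `b` to `b′`.
    independent : Dual b x → Dual b′ y → indices (products x (x ∷ b)) ≡ indices (products y (y ∷ b′)) →
      ∃[ φ ] IsOrthogonal φ × Maps φ (x ∷ b) (y ∷ b′)
    independent dual dual′ eq with indices-injective (products x (x ∷ b)) (products y (y ∷ b′)) eq
    ... | xx≈yy ∷ xb≈yb with extend {b = b′} {θ x} {y} (norms bs xb≈yb)
                               (trans (sym xx≈yy) (·-image {x} {w = x} (λ _ → refl) (λ _ → refl)))
                               (dual-image {v = x} bs (λ _ → refl) dual) dual′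
      where
      norms : ∀ {r} {b b′ : Vec V r} → Maps θ b b′ → Pointwise _≈_ (products x b) (products y b′) →
              All (λ v → y · v ≈ θ x · v) b′
      norms []       []       = []
      norms {b = w ∷ _} (e ∷ es) (p ∷ ps) =
        trans (sym p) (·-image {x} {w = w} (λ _ → refl) e) ∷ norms es ps
    ...   | φ , Φ , fixed , φθx≈y = φ ∘ θ , ∘-orthogonal Φ Θ , φθx≈y ∷ images bs fixed
      where
      images : ∀ {r} {b b′ : Vec V r} → Maps θ b b′ → All (λ v → φ v ≈ᴹ v) b′ → Maps (φ ∘ θ) b b′
      images []       []       = []
      images {b = w ∷ _} {w′ ∷ _} (e ∷ es) (p ∷ ps) =
        (λ i → trans (Orthogonal.cong Φ {θ w} {w′} e i) (p i)) ∷ images es ps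
    step : ∀ s → r ℕ.+ s ≡ d → (p : Span b x ⊎ Dual b x) (p′ : Span b′ y ⊎ Dual b′ y) →
           codeStep n s b x (xs ∘ suc) p ≡ codeStep n s b′ y (ys ∘ suc) p′ → Extension
    step zero    dim (inj₂ dual) p′           eq = no-further dim indep dual
    step zero    dim (inj₁ _)    (inj₂ dual′) eq = no-further dim (independent-image bs indep) dual′
    step zero    dim (inj₁ p)    (inj₁ p′)    eq with ,-injective eq
    ... | eq₁ , eq₂ = spanned p p′ eq₁ (code-complete n zero Θ indep dim bs eq₂)
    step (suc s) dim (inj₁ p)    (inj₁ p′)    eq with ,-injective (inj₁-injective eq)
    ... | eq₁ , eq₂ = spanned p p′ eq₁ (code-complete n (suc s) Θ indep dim bs eq₂)
    step (suc s) dim (inj₂ dual) (inj₂ dual′) eq with ,-injective (inj₂-injective eq)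
    ... | eq₁ , eq₂ with independent dual dual′ eq₁
    ...   | φ , Φ , maps with code-complete n s Φ (dual ∷ indep) (≡.trans (≡.sym (ℕ.+-suc r s)) dim) maps eq₂
    ...     | φ′ , Φ′ , (xy ∷ bs′) , xys = φ′ , Φ′ , bs′ , λ where
      zero    → xy
      (suc i) → xys i

-- Quotients with a finite complete invariant

-- Renumbers the values of `g` without gaps: an index opens a new class exactly when its value does
-- not recur at a later index.
kernel-quotient : ∀ {m n} (g : Fin m → Fin n) →
  ∃[ N ] Σ[ f ∈ (Fin m → Fin N) ] (∀ {i j} → g i ≡ g j → f i ≡ f j) × (∀ {i j} → f i ≡ f j → g i ≡ g j) ×
                (∀ y → ∃[ i ] f i ≡ y)
kernel-quotient {zero}  g = 0 , (λ ()) , (λ { {()} }) , (λ { {()} }) , λ ()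
kernel-quotient {suc m} g with kernel-quotient (g ∘ suc) | Fin.any? (λ j → g (suc j) Fin.≟ g zero)
... | N , f , cong , inj , surj | yes (j , gj≡g0) = N , f′ , cong′ , inj′ , surj′
  where
  f′ : Fin (suc m) → Fin N
  f′ zero    = f j
  f′ (suc i) = f i
  cong′ : ∀ {i i′} → g i ≡ g i′ → f′ i ≡ f′ i′
  cong′ {zero}  {zero}   eq = ≡.refl
  cong′ {zero}  {suc i′} eq = cong (≡.trans gj≡g0 eq)
  cong′ {suc i} {zero}   eq = cong (≡.trans eq (≡.sym gj≡g0))
  cong′ {suc i} {suc i′} eq = cong eq
  inj′ : ∀ {i i′} → f′ i ≡ f′ i′ → g i ≡ g i′
  inj′ {zero}  {zero}   eq = ≡.refl
  inj′ {zero}  {suc i′} eq = ≡.trans (≡.sym gj≡g0) (inj eq)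
  inj′ {suc i} {zero}   eq = ≡.trans (inj eq) gj≡g0
  inj′ {suc i} {suc i′} eq = inj eq
  surj′ : ∀ y → ∃[ i ] f′ i ≡ y
  surj′ y with surj y
  ... | i , eq = suc i , eq
... | N , f , cong , inj , surj | no new = suc N , f′ , cong′ , inj′ , surj′
  where
  f′ : Fin (suc m) → Fin (suc N)
  f′ zero    = zero
  f′ (suc i) = suc (f i)
  cong′ : ∀ {i i′} → g i ≡ g i′ → f′ i ≡ f′ i′
  cong′ {zero}  {zero}   eq = ≡.refl
  cong′ {zero}  {suc i′} eq = contradiction (i′ , ≡.sym eq) new
  cong′ {suc i} {zero}   eq = contradiction (i , eq) new
  cong′ {suc i} {suc i′} eq = ≡.cong suc (cong eq)
  inj′ : ∀ {i i′} → f′ i ≡ f′ i′ → g i ≡ g i′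
  inj′ {zero}  {zero}   eq = ≡.refl
  inj′ {suc i} {suc i′} eq = inj (Fin.suc-injective eq)
  surj′ : ∀ y → ∃[ i ] f′ i ≡ y
  surj′ zero    = zero , ≡.refl
  surj′ (suc y) with surj y
  ... | i , eq = suc i , ≡.cong suc eq

module _ {a ℓ} {A : Set a} {_~_ : Rel A ℓ} where

  -- Over a setoid carrier, `A` need not be finite up to propositional equality. A finite table that
  -- represents every element up to the value of `g` is enough to apply `kernel-quotient`.
  hasCardinality : ∀ {m n} (g : A → Fin n) → (∀ {x y} → x ~ y → g x ≡ g y) →
    (∀ {x y} → g x ≡ g y → x ~ y) →
    (index : A → Fin m) (element : Fin m → A) → (∀ x → g (element (index x)) ≡ g x) →
    ∃[ N ] HasCardinality _~_ N
  hasCardinality g invariant complete index element covers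
    with kernel-quotient (g ∘ element)
  ... | N , f , f-cong , f-inj , f-surj = N , f ∘ index ,
    class-cong ,
    (λ {x} {y} eq → complete (≡.trans (≡.sym (covers x)) (≡.trans (f-inj eq) (covers y)))) ,
    λ y → let i , fi≡y = f-surj y in element i , λ z~i →
      ≡.trans (class-cong z~i) (≡.trans (f-cong (covers (element i))) fi≡y)
    where
    class-cong : ∀ {x y} → x ~ y → f (index x) ≡ f (index y)
    class-cong {x} {y} x~y = f-cong (≡.trans (covers x) (≡.trans (invariant x~y) (≡.sym (covers y))))

  cardinality≤ : ∀ {m N} → HasCardinality _~_ N → (g : A → Fin m) →
                 (∀ {x y} → x ~ y → g x ≡ g y) → (∀ {x y} → g x ≡ g y → x ~ y) → N ℕ.≤ m
  cardinality≤ (f , f-cong , f-inj , f-surj) g invariant complete =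
    Fin.injective⇒≤ {f = λ y → g (proj₁ (f-surj y))} λ {y} {z} eq →
      ≡.trans (≡.sym (fiber y)) (≡.trans (f-cong (complete eq)) (fiber z))
    where
    fiber : ∀ y → f (proj₁ (f-surj y)) ≡ y
    -- Surjectivity speaks of everything related to the chosen preimage; `complete ≡.refl` relates
    -- that preimage to itself.
    fiber y = proj₂ (f-surj y) (complete ≡.refl)

-- Congruence classes and the upper bound

module UpperBound {c ℓ₁ ℓ₂} (F : HeytingField c ℓ₁ ℓ₂) (q : ℕ)
                  (order : Configurations.FieldHasOrder F q) (d : ℕ)
                  (2≉0 : OddCharacteristic F) where

  open FiniteField F q order
  open Configurations F
  open RawLeftModule (Space d) using (_≈ᴹ_; _+ᴹ_; 0ᴹ; -ᴹ_) renaming (Carrierᴹ to V)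
  open LinearAlgebra F q order d
  open Classification F q order d 2≉0
  open import Relation.Binary.Reasoning.Setoid setoid

  differences : ∀ {k} → Configuration {d} k → Fin k → V
  differences x i = x (suc i) +ᴹ -ᴹ x zero

  congruenceCode : ∀ {k} → Configuration {d} k → Code q k 0 d
  congruenceCode {k} x = code k d [] (differences x)

  congruenceCode-invariant : ∀ {k} (x y : Configuration {d} k) → x ∼ y → congruenceCode x ≡ congruenceCode y
  congruenceCode-invariant {k} x y (θ , Θ , z , y≈) =
    code-invariant k d Θ [] ≡.refl [] λ i j → begin
      θ (x (suc i) +ᴹ -ᴹ x zero) j           ≈⟨ +ᴹ-homo (x (suc i)) (-ᴹ x zero) j ⟩
      θ (x (suc i)) j + θ (-ᴹ x zero) j      ≈⟨ +-congˡ (-ᴹ-homo (x zero) j) ⟩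
      θ (x (suc i)) j - θ (x zero) j         ≈⟨ shift (θ (x (suc i)) j) (θ (x zero) j) (z j) ⟨
      (θ (x (suc i)) j + z j) - (θ (x zero) j + z j) ≈⟨ +-cong (y≈ (suc i) j) (-‿cong (y≈ zero j)) ⟨
      y (suc i) j - y zero j                 ∎
    where
    open Orthogonal Θ
    shift : ∀ s t z → (s + z) - (t + z) ≈ s - t
    shift s t z = begin
      (s + z) + - (t + z)      ≈⟨ +-congˡ (-‿+-comm t z) ⟨
      (s + z) + (- t + - z)
        ≈⟨ solve 4 (λ s z t z′ → (s :+ z) :+ (t :+ z′) := s :+ t :+ (z :+ z′)) refl s z (- t) (- z) ⟩
      s + - t + (z + - z)      ≈⟨ +-congˡ (-‿inverseʳ z) ⟩
      s + - t + 0#             ≈⟨ +-identityʳ _ ⟩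
      s - t                    ∎

  congruenceCode-complete : ∀ {k} (x y : Configuration {d} k) → congruenceCode x ≡ congruenceCode y → x ∼ y
  congruenceCode-complete {k} x y eq with code-complete k d id-orthogonal [] ≡.refl [] eq
  -- The isometry matches differences with the first point, so the translation is forced to be the
  -- one that matches the first points.
  ... | φ , Φ , _ , φx≈y = φ , Φ , y zero +ᴹ -ᴹ φ (x zero) , translated
    where
    open Orthogonal Φ
    translated : ∀ i → y i ≈ᴹ φ (x i) +ᴹ (y zero +ᴹ -ᴹ φ (x zero))
    translated zero j = begin
      y zero j                                       ≈⟨ +-identityʳ _ ⟨
      y zero j + 0#                                  ≈⟨ +-congˡ (-‿inverseʳ (φ (x zero) j)) ⟨
      y zero j + (φ (x zero) j + - φ (x zero) j)
        ≈⟨ solve 3 (λ y p n → y :+ (p :+ n) := p :+ (y :+ n)) refl (y zero j) (φ (x zero) j) (- φ (x zero) j) ⟩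
      φ (x zero) j + (y zero j + - φ (x zero) j)     ∎
    translated (suc i) j = begin
      y (suc i) j                                    ≈⟨ +-identityʳ _ ⟨
      y (suc i) j + 0#                               ≈⟨ +-congˡ (-‿inverseʳ (y zero j)) ⟨
      y (suc i) j + (y zero j + - y zero j)
        ≈⟨ solve 3 (λ y p n → y :+ (p :+ n) := y :+ n :+ p) refl (y (suc i) j) (y zero j) (- y zero j) ⟩
      (y (suc i) j - y zero j) + y zero j            ≈⟨ +-congʳ (φx≈y i j) ⟨
      φ (x (suc i) +ᴹ -ᴹ x zero) j + y zero j        ≈⟨ +-congʳ (+ᴹ-homo (x (suc i)) (-ᴹ x zero) j) ⟩
      φ (x (suc i)) j + φ (-ᴹ x zero) j + y zero j   ≈⟨ +-congʳ (+-congˡ (-ᴹ-homo (x zero) j)) ⟩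
      φ (x (suc i)) j + - φ (x zero) j + y zero j
        ≈⟨ solve 3 (λ p n y → p :+ n :+ y := p :+ (y :+ n)) refl (φ (x (suc i)) j) (- φ (x zero) j) (y zero j) ⟩
      φ (x (suc i)) j + (y zero j - φ (x zero) j)    ∎

  ≈⇒∼ : ∀ {k} (x y : Configuration {d} k) → (∀ i → y i ≈ᴹ x i) → x ∼ y
  ≈⇒∼ x y y≈x = (λ v → v) , id-orthogonal , 0ᴹ , λ i j → trans (y≈x i j) (sym (+-identityʳ _))

  cardinality : ∀ k → ∃[ N ] ΔHasCardinality d k U N × N ℕ.≤ codes q k 0 d
  cardinality k = _ , proj₂ counted , cardinality≤ (proj₂ counted) g invariant complete
    where
    g : ConfigurationIn U k → Fin (codes q k 0 d)
    g (x , _) = Inverse.to (Code↔Fin q k 0 d) (congruenceCode x)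
    invariant : ∀ {x y} → Congruence U k x y → g x ≡ g y
    invariant {x , _} {y , _} = ≡.cong (Inverse.to (Code↔Fin q k 0 d)) ∘ congruenceCode-invariant x y
    complete : ∀ {x y} → g x ≡ g y → Congruence U k x y
    complete {x , _} {y , _} = congruenceCode-complete x y ∘ ↔-injective (Code↔Fin q k 0 d)
    encoding = Vec↔Fin (Vec↔Fin (↔-refl {A = Fin q}) d) (suc k)
    position : ConfigurationIn U k → Fin ((q ℕ.^ d) ℕ.^ suc k)
    position (x , _) = Inverse.to encoding (Vec.tabulate λ i → Vec.tabulate (index ∘ x i))
    configuration : Fin ((q ℕ.^ d) ℕ.^ suc k) → ConfigurationIn U k
    configuration p = (λ i j → element (lookup (lookup (Inverse.from encoding p) i) j)) , _
    covers : ∀ x → g (configuration (position x)) ≡ g x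
    covers x@(vs , _) = invariant (≈⇒∼ _ vs λ i j → begin
      vs i j                                      ≈⟨ element-index (vs i j) ⟨
      element (index (vs i j))                    ≡⟨ ≡.cong element (decoded i j) ⟨
      proj₁ (configuration (position x)) i j      ∎)
      where
      table : Vec (Vec (Fin q) d) (suc k)
      table = Vec.tabulate λ i → Vec.tabulate (index ∘ vs i)
      decoded : ∀ i j → lookup (lookup (Inverse.from encoding (Inverse.to encoding table)) i) j ≡ index (vs i j)
      decoded i j = ≡.trans
        (≡.cong (λ t → lookup (lookup t i) j) (Inverse.strictlyInverseʳ encoding table))
        (≡.trans (≡.cong (λ v → lookup v j) (Vec.lookup∘tabulate (λ i → Vec.tabulate (index ∘ vs i)) i))
                 (Vec.lookup∘tabulate (index ∘ vs i) j))
    counted : ∃[ N ] HasCardinality (Congruence U k) N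
    counted = hasCardinality g invariant complete position configuration covers

-- Triangular normal forms and the lower bound

module _ (q-1 : ℕ) where

  -- An upper triangular d × d matrix with nonzero diagonal: its first row,
  -- then the matrix left after removing the first row and column.
  Triangular : ℕ → Set
  Triangular zero    = ⊤
  Triangular (suc d) = (Fin q-1 × Vec (Fin (suc q-1)) d) × Triangular d

  triangulars : ℕ → ℕ
  triangulars zero    = 1
  triangulars (suc d) = (q-1 ℕ.* suc q-1 ℕ.^ d) ℕ.* triangulars d

  Triangular↔Fin : ∀ d → Triangular d ↔ Fin (triangulars d)
  Triangular↔Fin zero    = ↔-sym Fin.1↔⊤
  Triangular↔Fin (suc d) = ↔-trans
    (↔-trans (↔-refl ×-↔ Vec↔Fin ↔-refl d) (↔-sym Fin.*↔×) ×-↔ Triangular↔Fin d) (↔-sym Fin.*↔×)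

module LowerBound {c ℓ₁ ℓ₂} (F : HeytingField c ℓ₁ ℓ₂) (q-1 : ℕ)
                  (order : Configurations.FieldHasOrder F (suc q-1))
                  (2≉0 : OddCharacteristic F) where

  open FiniteField F (suc q-1) order
  open Configurations F
  open import Relation.Binary.Reasoning.Setoid setoid

  private
    q = suc q-1

  nonzero : Fin q-1 → Carrier
  nonzero i = element (punchIn (index 0#) i)

  nonzero≉0 : ∀ i → nonzero i ≉ 0#
  nonzero≉0 i eq = Fin.punchInᵢ≢i (index 0#) i
    (≡.trans (≡.sym (index-element _)) (index-cong eq))

  nonzero-injective : ∀ {i j} → nonzero i ≈ nonzero j → i ≡ j
  nonzero-injective {i} {j} eq = Fin.punchIn-injective (index 0#) i j (element-injective eq)

  elements : ∀ {n} → Vec (Fin q) n → Fin n → Carrier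
  elements is j = element (lookup is j)

  elements-injective : ∀ {n} (is js : Vec (Fin q) n) → (∀ i → elements is i ≈ elements js i) → is ≡ js
  elements-injective []       []       eq = ≡.refl
  elements-injective (_ ∷ is) (_ ∷ js) eq =
    ≡.cong₂ _∷_ (element-injective (eq zero)) (elements-injective is js (eq ∘ suc))

  -- Separates a from - a for a ≉ 0.
  sign : Carrier → Bool
  sign a = does (index a Fin.<? index (- a))

  sign-cong : ∀ {a b} → a ≈ b → sign a ≡ sign b
  sign-cong a≈b = ≡.cong₂ (λ i j → does (i Fin.<? j)) (index-cong a≈b) (index-cong (-‿cong a≈b))

  a≈-a⇒a≈0 : ∀ {a} → a ≈ - a → a ≈ 0#
  a≈-a⇒a≈0 {a} eq = *-cancelˡ 2≉0 (begin
    (1# + 1#) * a   ≈⟨ trans (distribʳ a 1# 1#) (+-cong (*-identityˡ a) (*-identityˡ a)) ⟩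
    a + a           ≈⟨ +-congˡ eq ⟩
    a - a           ≈⟨ -‿inverseʳ a ⟩
    0#              ≈⟨ zeroʳ _ ⟨
    (1# + 1#) * 0#  ∎)

  -- Passing from `a` to its negative swaps the two indices compared. Equal outcomes of a strict
  -- comparison and its swap force equal indices, hence a = - a, impossible for nonzero `a` as 2 is
  -- invertible.
  sign-neg : ∀ {a} → a ≉ 0# → ¬ (sign a ≡ sign (- a))
  sign-neg {a} a≉0 eq = a≉0 (a≈-a⇒a≈0 (index-injective (symmetric⇒≡ _ _
    (≡.trans eq (≡.cong (λ i → does (index (- a) Fin.<? i)) (index-cong (-‿involutive a)))))))
    where
    symmetric⇒≡ : ∀ (i j : Fin q) → does (i Fin.<? j) ≡ does (j Fin.<? i) → i ≡ j
    symmetric⇒≡ i j eq with Fin.<-cmp i j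
    ... | tri≈ _   i≡j _   = i≡j
    ... | tri< i<j _   j≮i = contradiction
      (≡.trans (≡.sym (dec-true (i Fin.<? j) i<j)) (≡.trans eq (dec-false (j Fin.<? i) j≮i))) λ ()
    ... | tri> i≮j _   j<i = contradiction
      (≡.trans (≡.sym (dec-false (i Fin.<? j) i≮j)) (≡.trans eq (dec-true (j Fin.<? i) j<i))) λ ()

  -- From (a - b)(a + b) = 0, the only alternative to a = b is b = - a, which the signs exclude.
  square-injective : ∀ {a b} → a ≉ 0# → a * a ≈ b * b → sign a ≡ sign b → a ≈ b
  square-injective {a} {b} a≉0 aa≈bb eq with a ≟ b
  ... | yes a≈b = a≈b
  ... | no  a≉b = contradiction (≡.trans eq (sign-cong b≈-a)) (sign-neg a≉0)
    where
    a-b≉0 : a - b ≉ 0#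
    a-b≉0 = a≉b ∘ x∙y⁻¹≈ε⇒x≈y a b
    b≈-a : b ≈ - a
    b≈-a = +-cancelˡ {a} (*-cancelˡ a-b≉0 (begin
      (a + - b) * (a + b)
        ≈⟨ solve 3 (λ a b n → (a :+ n) :* (a :+ b) := a :* a :+ n :* b :+ a :* (b :+ n)) refl a b (- b) ⟩
      a * a + - b * b + a * (b + - b)
        ≈⟨ +-cong (+-cong aa≈bb (sym (-‿distribˡ-* b b))) (trans (*-congˡ (-‿inverseʳ b)) (zeroʳ a)) ⟩
      b * b + - (b * b) + 0#           ≈⟨ trans (+-identityʳ _) (-‿inverseʳ (b * b)) ⟩
      0#                               ≈⟨ trans (*-congˡ (-‿inverseʳ a)) (zeroʳ _) ⟨
      (a + - b) * (a + - a)            ∎))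

  rows : ∀ {d} → Triangular q-1 d → Fin d → Fin d → Carrier
  rows {suc d} ((a , as) , t) zero    = nonzero a Vector.∷ elements as
  rows {suc d} ((a , as) , t) (suc i) = 0# Vector.∷ rows t i

  signs : ∀ {d} → Triangular q-1 d → Vec Bool d
  signs {zero}  t              = []
  signs {suc d} ((a , as) , t) = sign (nonzero a) ∷ signs t

  private
    drop-zero : ∀ {x y} {s t : Carrier} → 0# * x + s ≈ 0# * y + t → s ≈ t
    drop-zero eq = trans (sym (clear _ _)) (trans eq (clear _ _))
      where
      clear : ∀ x s → 0# * x + s ≈ s
      clear x s = trans (+-congʳ (zeroˡ x)) (+-identityˡ s)

  -- Back substitution: the lower rows settle all coordinates but the first, and the nonzero pivot
  -- of the first row settles that one.
  rows-nondegenerate : ∀ {d} (t : Triangular q-1 d) (u w : Fin d → Carrier) →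
    (∀ i → rows t i · u ≈ rows t i · w) → ∀ i → u i ≈ w i
  rows-nondegenerate {suc d} ((a , as) , t) u w eq = λ where
      zero    → *-cancelˡ (nonzero≉0 a) (+-cancelʳ (trans (eq zero)
                  (+-congˡ (LinearAlgebra.·-cong F q order d {elements as} (λ _ → refl) (sym ∘ rest)))))
      (suc i) → rest i
    where
    rest : ∀ i → u (suc i) ≈ w (suc i)
    rest = rows-nondegenerate t (u ∘ suc) (w ∘ suc) (drop-zero ∘ eq ∘ suc)

  -- Uniqueness of a Cholesky factorisation, read from the bottom up. The lower rows are known by
  -- induction; their products with the first row determine its tail by nondegeneracy. The norm of
  -- the first row then leaves the square of the pivot, and the sign picks the root.
  rows-injective : ∀ {d} (t t′ : Triangular q-1 d) →
    (∀ i j → rows t i · rows t j ≈ rows t′ i · rows t′ j) → signs t ≡ signs t′ → t ≡ t′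
  rows-injective {zero}  tt tt eq _ = ≡.refl
  rows-injective {suc d} ((a , as) , t) ((e , es) , t′) eq signs≡ with Vec.∷-injective signs≡
  ... | sign≡ , signs≡ with rows-injective t t′ (λ i j → drop-zero (eq (suc i) (suc j))) signs≡
  ... | ≡.refl with elements-injective as es (rows-nondegenerate t _ _ (λ i → drop-zero (eq (suc i) zero)))
  ... | ≡.refl with nonzero-injective (square-injective (nonzero≉0 a) (+-cancelʳ (eq zero zero)) sign≡)
  ... | ≡.refl = ≡.refl

  module _ {d : ℕ} (m : ℕ) where

    open RawLeftModule (Space d) using (_≈ᴹ_; _+ᴹ_; 0ᴹ) renaming (Carrierᴹ to V)
    open LinearAlgebra F q order d

    NormalForm : Set
    NormalForm = Triangular q-1 d × Vec (Vec (Fin q) d) m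

    NormalForm↔Fin : NormalForm ↔ Fin (triangulars q-1 d ℕ.* (q ℕ.^ d) ℕ.^ m)
    NormalForm↔Fin = ↔-trans (Triangular↔Fin q-1 d ×-↔ Vec↔Fin (Vec↔Fin ↔-refl d) m) (↔-sym Fin.*↔×)

    vectors : NormalForm → Fin (d ℕ.+ m) → V
    vectors (t , vs) i = [ rows t , elements ∘ lookup vs ]′ (splitAt d i)

    configuration : NormalForm → Configuration {d} (d ℕ.+ m)
    configuration x zero    = 0ᴹ
    configuration x (suc i) = vectors x i

    products-preserved : ∀ x y → configuration x ∼ configuration y →
      ∀ i j → vectors x i · vectors x j ≈ vectors y i · vectors y j
    products-preserved x y (θ , Θ , z , y≈) i j =
      trans (sym (·-preserving (vectors x i) (vectors x j)))
            (·-cong {θ (vectors x i)} {vectors y i} {θ (vectors x j)} (θx≈y i) (θx≈y j))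
      where
      open Orthogonal Θ
      -- Both configurations start at the origin, which a linear map fixes, so no translation
      -- remains.
      z≈0 : z ≈ᴹ 0ᴹ
      z≈0 i = begin
        z i            ≈⟨ +-identityˡ (z i) ⟨
        0# + z i       ≈⟨ +-congʳ (0ᴹ-homo i) ⟨
        θ 0ᴹ i + z i   ≈⟨ y≈ zero i ⟨
        0#             ∎
      θx≈y : ∀ i → θ (vectors x i) ≈ᴹ vectors y i
      θx≈y i j = sym (trans (y≈ (suc i) j) (trans (+-congˡ (z≈0 j)) (+-identityʳ _)))

    configuration-injective : ∀ x y → configuration x ∼ configuration y →
                              signs (proj₁ x) ≡ signs (proj₁ y) → x ≡ y
    configuration-injective x@(t , vs) y@(t′ , vs′) x∼y signs≡ with rows-injective t t′ rows·rows signs≡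
      where
      rows·rows : ∀ i j → rows t i · rows t j ≈ rows t′ i · rows t′ j
      rows·rows i j with products-preserved x y x∼y (i ↑ˡ m) (j ↑ˡ m)
      ... | eq rewrite Fin.splitAt-↑ˡ d i m | Fin.splitAt-↑ˡ d j m = eq
    ... | ≡.refl = ≡.cong (t ,_) (rowwise vs vs′ λ l → elements-injective _ _
                     (rows-nondegenerate t _ _ λ i → rows·vector i l))
      where
      rows·vector : ∀ i l → rows t i · elements (lookup vs l) ≈ rows t i · elements (lookup vs′ l)
      rows·vector i l with products-preserved x y x∼y (i ↑ˡ m) (d ↑ʳ l)
      ... | eq rewrite Fin.splitAt-↑ˡ d i m | Fin.splitAt-↑ʳ d m l = eq
      rowwise : ∀ {n} (vs vs′ : Vec (Vec (Fin q) d) n) → (∀ l → lookup vs l ≡ lookup vs′ l) → vs ≡ vs′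
      rowwise []       []       eq = ≡.refl
      rowwise (_ ∷ vs) (_ ∷ ws) eq = ≡.cong₂ _∷_ (eq zero) (rowwise vs ws (eq ∘ suc))

    ≤cardinality : ∀ {N} → ΔHasCardinality d (d ℕ.+ m) U N →
                   triangulars q-1 d ℕ.* (q ℕ.^ d) ℕ.^ m ℕ.≤ N ℕ.* 2 ℕ.^ d
    ≤cardinality {N} (class , _ , class-injective , _) =
      finite-injection⇒≤ NormalForm↔Fin
        (↔-trans (↔-refl ×-↔ Vec↔Fin (↔-sym Fin.2↔Bool) d) (↔-sym Fin.*↔×))
        {λ x → class (configuration x , _) , signs (proj₁ x)}
        λ {x} {y} eq → let class≡ , signs≡ = ,-injective eq in
          configuration-injective x y (class-injective class≡) signs≡

open import Data.Nat.Combinatorics using (_C_; nCk+nC[k+1]≡[n+1]C[k+1]; nC1≡n)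
open import Data.Nat.Base using (_+_; _*_; _∸_; _^_; _≤_; _<_; NonZero; s≤s)

-- Estimates for the two counts

module _ where

  open import Data.Nat.Properties
  open import Data.Nat.Solver using (module +-*-Solver)
  open +-*-Solver using (solve; _:+_; _:*_; _:=_; con)
  open ≡ using (refl; cong; sym; trans)

  [1+n]C2≡nC2+n : ∀ n → suc n C 2 ≡ n C 2 + n
  [1+n]C2≡nC2+n n = trans (sym (nCk+nC[k+1]≡[n+1]C[k+1] n 1)) (trans (+-comm (n C 1) (n C 2)) (cong (n C 2 +_) (nC1≡n n)))

  nC2+nC2+n≡n*n : ∀ n → n C 2 + n C 2 + n ≡ n * n
  nC2+nC2+n≡n*n zero    = refl
  nC2+nC2+n≡n*n (suc n) = begin-equality
    suc n C 2 + suc n C 2 + suc n         ≡⟨ cong (λ t → t + t + suc n) ([1+n]C2≡nC2+n n) ⟩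
    n C 2 + n + (n C 2 + n) + suc n
      ≡⟨ solve 2 (λ t n → t :+ n :+ (t :+ n) :+ (con 1 :+ n) := t :+ t :+ n :+ (con 1 :+ n :+ n)) refl (n C 2) n ⟩
    n C 2 + n C 2 + n + (1 + n + n)       ≡⟨ cong (_+ (1 + n + n)) (nC2+nC2+n≡n*n n) ⟩
    n * n + (1 + n + n)
      ≡⟨ solve 1 (λ n → n :* n :+ (con 1 :+ n :+ n) := (con 1 :+ n) :* (con 1 :+ n)) refl n ⟩
    suc n * suc n                         ∎
    where open ≤-Reasoning

  -- Pascal's rule if n ≤ s; otherwise the left side is 0. It controls the extra term of
  -- `codes-bound` when a vector is read without enlarging the basis.
  [1+s∸n]C2≤ : ∀ s n → (suc s ∸ n) C 2 ≤ s + (s ∸ n) C 2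
  [1+s∸n]C2≤ s n with ≤-<-connex n s
  ... | inj₂ s<n rewrite m≤n⇒m∸n≡0 s<n = ℕ.z≤n
  ... | inj₁ n≤s rewrite +-∸-assoc 1 n≤s | [1+n]C2≡nC2+n (s ∸ n) | +-comm ((s ∸ n) C 2) (s ∸ n) =
    +-monoˡ-≤ ((s ∸ n) C 2) (m∸n≤m s n)

  -- The term (s ∸ n) C 2, absent when n ≥ s, makes the induction on n go through.
  codes-bound : ∀ q → 2 ≤ q → ∀ n r s →
    codes q n r s * q ^ (s C 2) ≤ 2 ^ s * q ^ ((r + s) * n + (s ∸ n) C 2)
  codes-bound q 2≤q zero r s = begin
    1 * q ^ (s C 2)                     ≤⟨ *-monoˡ-≤ (q ^ (s C 2)) (m^n>0 2 s) ⟩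
    2 ^ s * q ^ (s C 2)                 ≡⟨ cong (λ e → 2 ^ s * q ^ (e + s C 2)) (*-zeroʳ (r + s)) ⟨
    2 ^ s * q ^ ((r + s) * 0 + s C 2)   ∎
    where open ≤-Reasoning
  codes-bound q 2≤q (suc n) r zero = begin
    q ^ r * codes q n r 0 * 1                     ≡⟨ *-assoc (q ^ r) _ 1 ⟩
    q ^ r * (codes q n r 0 * 1)                   ≤⟨ *-monoʳ-≤ (q ^ r) (codes-bound q 2≤q n r zero) ⟩
    q ^ r * (1 * q ^ ((r + 0) * n + (0 ∸ n) C 2))
      ≡⟨ cong (λ e → q ^ r * (1 * q ^ ((r + 0) * n + e C 2))) (0∸n≡0 n) ⟩
    q ^ r * (1 * q ^ ((r + 0) * n + 0))           ≡⟨ cong (q ^ r *_) (*-identityˡ _) ⟩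
    q ^ r * q ^ ((r + 0) * n + 0)                 ≡⟨ ^-distribˡ-+-* q r _ ⟨
    q ^ (r + ((r + 0) * n + 0))
      ≡⟨ cong (q ^_) (solve 2 (λ r n → r :+ ((r :+ con 0) :* n :+ con 0) := (r :+ con 0) :* (con 1 :+ n) :+ con 0) refl r n) ⟩
    q ^ ((r + 0) * suc n + 0)                     ≡⟨ *-identityˡ _ ⟨
    1 * q ^ ((r + 0) * suc n + 0)                 ∎
    where open ≤-Reasoning
  codes-bound q 2≤q (suc n) r (suc s) = begin
    (q ^ r * c₁ + q ^ suc r * c₂) * q ^ (suc s C 2)
      ≡⟨ *-distribʳ-+ (q ^ (suc s C 2)) (q ^ r * c₁) (q ^ suc r * c₂) ⟩
    q ^ r * c₁ * q ^ (suc s C 2) + q ^ suc r * c₂ * q ^ (suc s C 2)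
      ≤⟨ +-mono-≤ dependent independent ⟩
    2 ^ s * X + 2 ^ s * X
      ≡⟨ solve 2 (λ a b → a :* b :+ a :* b := con 2 :* a :* b) refl (2 ^ s) X ⟩
    2 ^ suc s * X ∎
    where
    open ≤-Reasoning
    instance
      q≢0 : NonZero q
      q≢0 = ℕ.>-nonZero (≤-trans (ℕ.s≤s ℕ.z≤n) 2≤q)
    c₁ = codes q n r (suc s)
    c₂ = codes q n (suc r) s
    D = r + suc s
    X = q ^ (D * suc n + (s ∸ n) C 2)
    -- The bound for `suc s` brings a factor 2 too many. The exponent D = r + 1 + s has room for it:
    -- r goes to the coordinates, s to `[1+s∸n]C2≤`, and 1 to replacing that 2 by `q`.
    dependent : q ^ r * c₁ * q ^ (suc s C 2) ≤ 2 ^ s * X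
    dependent = begin
      q ^ r * c₁ * q ^ (suc s C 2)                          ≡⟨ *-assoc (q ^ r) c₁ _ ⟩
      q ^ r * (c₁ * q ^ (suc s C 2))
        ≤⟨ *-monoʳ-≤ (q ^ r) (codes-bound q 2≤q n r (suc s)) ⟩
      q ^ r * (2 ^ suc s * q ^ (D * n + (suc s ∸ n) C 2))
        ≡⟨ solve 3 (λ a b c → a :* (con 2 :* b :* c) := b :* (con 2 :* (a :* c))) refl (q ^ r) (2 ^ s) _ ⟩
      2 ^ s * (2 * (q ^ r * q ^ (D * n + (suc s ∸ n) C 2))) ≤⟨ *-monoʳ-≤ (2 ^ s) (*-monoˡ-≤ _ 2≤q) ⟩
      2 ^ s * (q * (q ^ r * q ^ (D * n + (suc s ∸ n) C 2)))
        ≡⟨ cong (λ e → 2 ^ s * (q * e)) (^-distribˡ-+-* q r _) ⟨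
      2 ^ s * q ^ suc (r + (D * n + (suc s ∸ n) C 2))       ≤⟨ *-monoʳ-≤ (2 ^ s) (^-monoʳ-≤ q exponents) ⟩
      2 ^ s * X                                             ∎
      where
      exponents : suc (r + (D * n + (suc s ∸ n) C 2)) ≤ D * suc n + (s ∸ n) C 2
      exponents = begin
        suc (r + (D * n + (suc s ∸ n) C 2))     ≤⟨ ℕ.s≤s (+-monoʳ-≤ r (+-monoʳ-≤ (D * n) ([1+s∸n]C2≤ s n))) ⟩
        suc (r + (D * n + (s + (s ∸ n) C 2)))
          ≡⟨ solve 4 (λ r n s t → con 1 :+ (r :+ ((r :+ (con 1 :+ s)) :* n :+ (s :+ t))) := (r :+ (con 1 :+ s)) :* (con 1 :+ n) :+ t) refl r n s ((s ∸ n) C 2) ⟩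
        D * suc n + (s ∸ n) C 2                 ∎
    Y = q ^ ((suc r + s) * n + (s ∸ n) C 2)
    -- Pascal's rule splits off q ^ s from the factor on the left, which completes the q ^ (r + 1)
    -- records to q ^ D.
    independent : q ^ suc r * c₂ * q ^ (suc s C 2) ≤ 2 ^ s * X
    independent = begin
      q ^ suc r * c₂ * q ^ (suc s C 2)
        ≡⟨ cong (λ e → q ^ suc r * c₂ * q ^ e) ([1+n]C2≡nC2+n s) ⟩
      q ^ suc r * c₂ * q ^ (s C 2 + s)
        ≡⟨ cong (q ^ suc r * c₂ *_) (^-distribˡ-+-* q (s C 2) s) ⟩
      q ^ suc r * c₂ * (q ^ (s C 2) * q ^ s)
        ≡⟨ solve 4 (λ a b c d → a :* b :* (c :* d) := a :* d :* (b :* c)) refl (q ^ suc r) c₂ (q ^ (s C 2)) (q ^ s) ⟩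
      q ^ suc r * q ^ s * (c₂ * q ^ (s C 2))
        ≤⟨ *-monoʳ-≤ (q ^ suc r * q ^ s) (codes-bound q 2≤q n (suc r) s) ⟩
      q ^ suc r * q ^ s * (2 ^ s * Y)
        ≡⟨ solve 4 (λ a b c d → a :* b :* (c :* d) := c :* (a :* b :* d)) refl (q ^ suc r) (q ^ s) (2 ^ s) _ ⟩
      2 ^ s * (q ^ suc r * q ^ s * Y) ≡⟨ cong (λ e → 2 ^ s * (e * Y)) (^-distribˡ-+-* q (suc r) s) ⟨
      2 ^ s * (q ^ (suc r + s) * Y) ≡⟨ cong (2 ^ s *_) (^-distribˡ-+-* q (suc r + s) _) ⟨
      2 ^ s * q ^ (suc r + s + ((suc r + s) * n + (s ∸ n) C 2))
        ≡⟨ cong (λ e → 2 ^ s * q ^ e) (solve 4 (λ r n s t → con 1 :+ r :+ s :+ ((con 1 :+ r :+ s) :* n :+ t) := (r :+ (con 1 :+ s)) :* (con 1 :+ n) :+ t) refl r n s ((s ∸ n) C 2)) ⟩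
      2 ^ s * X                                                     ∎

  -- Each diagonal entry has q - 1 choices, at least half of q, which loses one factor 2 per row.
  triangulars-bound : ∀ q-1 → 1 ≤ q-1 → ∀ d → suc q-1 ^ (suc d C 2) ≤ 2 ^ d * triangulars q-1 d
  triangulars-bound q-1 1≤q-1 zero    = ≤-refl
  triangulars-bound q-1 1≤q-1 (suc d) = begin
    q ^ (suc (suc d) C 2)              ≡⟨ cong (q ^_) ([1+n]C2≡nC2+n (suc d)) ⟩
    q ^ (suc d C 2 + suc d)            ≡⟨ ^-distribˡ-+-* q (suc d C 2) (suc d) ⟩
    q ^ (suc d C 2) * (q * q ^ d)
      ≤⟨ *-mono-≤ (triangulars-bound q-1 1≤q-1 d) (*-monoˡ-≤ (q ^ d) q≤2[q-1]) ⟩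
    2 ^ d * T * (2 * q-1 * q ^ d)
      ≡⟨ solve 4 (λ a t p c → a :* t :* (con 2 :* p :* c) := con 2 :* a :* (p :* c :* t)) refl (2 ^ d) T q-1 (q ^ d) ⟩
    2 ^ suc d * (q-1 * q ^ d * T)      ∎
    where
    open ≤-Reasoning
    q = suc q-1
    T = triangulars q-1 d
    q≤2[q-1] : q ≤ 2 * q-1
    q≤2[q-1] = begin
      1 + q-1        ≤⟨ +-monoˡ-≤ q-1 1≤q-1 ⟩
      q-1 + q-1      ≡⟨ cong (q-1 +_) (+-identityʳ q-1) ⟨
      2 * q-1        ∎

  -- As d (d + 1) is twice `suc d C 2`, the minuend contains the subtrahend and the truncated
  -- subtraction is exact.
  exponent≡ : ∀ d m → d * (d + m + 1) ∸ (d + 1) C 2 ≡ d * m + suc d C 2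
  exponent≡ d m = begin-equality
    d * (d + m + 1) ∸ (d + 1) C 2
      ≡⟨ cong (λ e → d * (d + m + 1) ∸ e C 2) (+-comm d 1) ⟩
    d * (d + m + 1) ∸ suc d C 2                             ≡⟨ cong (_∸ suc d C 2) expand ⟩
    d * m + suc d C 2 + suc d C 2 ∸ suc d C 2               ≡⟨ m+n∸n≡m (d * m + suc d C 2) (suc d C 2) ⟩
    d * m + suc d C 2                                       ∎
    where
    open ≤-Reasoning
    expand : d * (d + m + 1) ≡ d * m + suc d C 2 + suc d C 2
    expand = begin-equality
      d * (d + m + 1)
        ≡⟨ solve 2 (λ d m → d :* (d :+ m :+ con 1) := d :* d :+ d :* m :+ d) refl d m ⟩
      d * d + d * m + d                        ≡⟨ cong (λ e → e + d * m + d) (nC2+nC2+n≡n*n d) ⟨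
      d C 2 + d C 2 + d + d * m + d
        ≡⟨ solve 3 (λ t d e → t :+ t :+ d :+ e :+ d := e :+ (t :+ d) :+ (t :+ d)) refl (d C 2) d (d * m) ⟩
      d * m + (d C 2 + d) + (d C 2 + d)        ≡⟨ cong (λ t → d * m + t + t) ([1+n]C2≡nC2+n d) ⟨
      d * m + suc d C 2 + suc d C 2            ∎

  -- Reading starts with r = 0 and s = d, and d + m vectors suffice to make the extra term of
  -- `codes-bound` vanish. The exponent d (d + m) exceeds the wanted one by `d C 2`, exactly the
  -- power cancelled.
  codes≤ : ∀ q → 2 ≤ q → ∀ d m → codes q (d + m) 0 d ≤ 2 ^ d * q ^ (d * m + suc d C 2)
  codes≤ q 2≤q d m = *-cancelʳ-≤ _ _ (q ^ (d C 2)) (begin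
    codes q (d + m) 0 d * q ^ (d C 2)               ≤⟨ codes-bound q 2≤q (d + m) 0 d ⟩
    2 ^ d * q ^ (d * (d + m) + (d ∸ (d + m)) C 2)
      ≡⟨ cong (λ e → 2 ^ d * q ^ (d * (d + m) + e C 2)) (m≤n⇒m∸n≡0 (m≤m+n d m)) ⟩
    2 ^ d * q ^ (d * (d + m) + 0)                   ≡⟨ cong (λ e → 2 ^ d * q ^ e) expand ⟩
    2 ^ d * q ^ (d * m + suc d C 2 + d C 2)
      ≡⟨ cong (2 ^ d *_) (^-distribˡ-+-* q (d * m + suc d C 2) (d C 2)) ⟩
    2 ^ d * (q ^ (d * m + suc d C 2) * q ^ (d C 2)) ≡⟨ *-assoc (2 ^ d) _ _ ⟨
    2 ^ d * q ^ (d * m + suc d C 2) * q ^ (d C 2)   ∎)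
    where
    open ≤-Reasoning
    instance
      q≢0 : NonZero q
      q≢0 = ℕ.>-nonZero (≤-trans (ℕ.s≤s ℕ.z≤n) 2≤q)
      q^≢0 : NonZero (q ^ (d C 2))
      q^≢0 = m^n≢0 q (d C 2)
    expand : d * (d + m) + 0 ≡ d * m + suc d C 2 + d C 2
    expand = begin-equality
      d * (d + m) + 0
        ≡⟨ solve 2 (λ d m → d :* (d :+ m) :+ con 0 := d :* d :+ d :* m) refl d m ⟩
      d * d + d * m                         ≡⟨ cong (_+ d * m) (nC2+nC2+n≡n*n d) ⟨
      d C 2 + d C 2 + d + d * m
        ≡⟨ solve 3 (λ t d e → t :+ t :+ d :+ e := e :+ (t :+ d) :+ t) refl (d C 2) d (d * m) ⟩
      d * m + (d C 2 + d) + d C 2           ≡⟨ cong (λ t → d * m + t + d C 2) ([1+n]C2≡nC2+n d) ⟨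
      d * m + suc d C 2 + d C 2             ∎

  power≤ : ∀ q-1 → 1 ≤ q-1 → ∀ d m {N} → triangulars q-1 d * (suc q-1 ^ d) ^ m ≤ N * 2 ^ d →
           suc q-1 ^ (d * m + suc d C 2) ≤ 2 ^ d * 2 ^ d * N
  power≤ q-1 1≤q-1 d m {N} T≤ = begin
    q ^ (d * m + suc d C 2)               ≡⟨ ^-distribˡ-+-* q (d * m) (suc d C 2) ⟩
    q ^ (d * m) * q ^ (suc d C 2)         ≤⟨ *-monoʳ-≤ (q ^ (d * m)) (triangulars-bound q-1 1≤q-1 d) ⟩
    q ^ (d * m) * (2 ^ d * T)             ≡⟨ cong (_* (2 ^ d * T)) (^-*-assoc q d m) ⟨
    (q ^ d) ^ m * (2 ^ d * T)
      ≡⟨ solve 3 (λ a b c → a :* (b :* c) := b :* (c :* a)) refl ((q ^ d) ^ m) (2 ^ d) T ⟩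
    2 ^ d * (T * (q ^ d) ^ m)             ≤⟨ *-monoʳ-≤ (2 ^ d) T≤ ⟩
    2 ^ d * (N * 2 ^ d)                   ≡⟨ solve 2 (λ a n → a :* (n :* a) := a :* a :* n) refl (2 ^ d) N ⟩
    2 ^ d * 2 ^ d * N                     ∎
    where
    open ≤-Reasoning
    q = suc q-1
    T = triangulars q-1 d

-- Oddness of the order, rational constants and conclusion

odd-prime-power : ∀ {q} → IsOddPrimePower q → ∃[ j ] q ≡ 1 + j * 2
odd-prime-power {q} (p , m , p-prime , p≢2 , _ , ≡.refl) = q ℕ./ 2 , halve (q ℕ.% 2) (m%n<n q 2) (m≡m%n+[m/n]*n q 2) (2∤p^ m ∘ m%n≡0⇒n∣m q 2)
  where
  2∤p^ : ∀ m → ¬ (2 ∣ p ^ m)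
  2∤p^ zero    2∣1 = contradiction (∣1⇒≡1 2∣1) λ ()
  2∤p^ (suc m) 2∣  with euclidsLemma p (p ^ m) prime[2] 2∣
  ... | inj₂ 2∣p^m = 2∤p^ m 2∣p^m
  ... | inj₁ 2∣p with prime⇒irreducible p-prime 2∣p
  ...   | inj₁ ()
  ...   | inj₂ 2≡p = p≢2 (≡.sym 2≡p)
  halve : ∀ r → suc r ≤ 2 → q ≡ r + q ℕ./ 2 * 2 → ¬ (r ≡ 0) → q ≡ 1 + q ℕ./ 2 * 2
  halve 0             _               _  r≢0 = contradiction ≡.refl r≢0
  halve 1             _               eq _   = eq
  halve (suc (suc r)) (s≤s (s≤s ())) _  _

-- `fromℕ` normalises its fraction; passing to unnormalised rationals turns order and products into
-- statements about integers.
fromℕ-toℚᵘ : ∀ n → ℚ.toℚᵘ (fromℕ n) ℚᵘ.≃ ℚᵘ.mkℚᵘ (ℤ.+ n) 0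
fromℕ-toℚᵘ n = ℚ.toℚᵘ-fromℚᵘ (ℚᵘ.mkℚᵘ (ℤ.+ n) 0)

fromℕ-mono-≤ : ∀ m n → m ≤ n → fromℕ m ℚ.≤ fromℕ n
fromℕ-mono-≤ m n m≤n = ℚ.toℚᵘ-cancel-≤ (begin
  ℚ.toℚᵘ (fromℕ m)        ≃⟨ fromℕ-toℚᵘ m ⟩
  ℚᵘ.mkℚᵘ (ℤ.+ m) 0       ≤⟨ ℚᵘ.*≤* (ℤ.*-monoʳ-≤-nonNeg (ℤ.+ 1) (ℤ.+≤+ m≤n)) ⟩
  ℚᵘ.mkℚᵘ (ℤ.+ n) 0       ≃⟨ fromℕ-toℚᵘ n ⟨
  ℚ.toℚᵘ (fromℕ n)        ∎)
  where open ℚᵘ.≤-Reasoning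

fromℕ-homo-* : ∀ m n → fromℕ (m * n) ≡ fromℕ m ℚ.* fromℕ n
fromℕ-homo-* m n = ℚ.toℚᵘ-injective (begin-equality
  ℚ.toℚᵘ (fromℕ (m * n))                        ≃⟨ fromℕ-toℚᵘ (m * n) ⟩
  ℚᵘ.mkℚᵘ (ℤ.+ (m * n)) 0                       ≡⟨ ≡.cong (λ i → ℚᵘ.mkℚᵘ i 0) (ℤ.pos-* m n) ⟩
  ℚᵘ.mkℚᵘ (ℤ.+ m) 0 ℚᵘ.* ℚᵘ.mkℚᵘ (ℤ.+ n) 0      ≃⟨ ℚᵘ.*-cong (fromℕ-toℚᵘ m) (fromℕ-toℚᵘ n) ⟨
  ℚ.toℚᵘ (fromℕ m) ℚᵘ.* ℚ.toℚᵘ (fromℕ n)        ≃⟨ ℚ.toℚᵘ-homo-* (fromℕ m) (fromℕ n) ⟨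
  ℚ.toℚᵘ (fromℕ m ℚ.* fromℕ n)                  ∎)
  where open ℚᵘ.≤-Reasoning

fromℕ-positive : ∀ n .{{_ : NonZero n}} → ℚ.Positive (fromℕ n)
fromℕ-positive n = ℚ.normalize-pos n 1

cardinality-bounds : ∀ {c ℓ₁ ℓ₂} d m q → 1 < q → (F : HeytingField c ℓ₁ ℓ₂) →
  Configurations.FieldHasOrder F q → OddCharacteristic F →
  ∃[ N ] Configurations.ΔHasCardinality F d (d + m) U N
    × q ^ (d * m + suc d C 2) ≤ 2 ^ d * 2 ^ d * N
    × N ≤ 2 ^ d * q ^ (d * m + suc d C 2)
cardinality-bounds d m (suc q-1) (s≤s 1≤q-1) F order 2≉0 =
  let N , card , N≤ = UpperBound.cardinality F (suc q-1) order d 2≉0 (d + m) in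
  N , card ,
  power≤ q-1 1≤q-1 d m (LowerBound.≤cardinality F q-1 order 2≉0 m card) ,
  ℕ.≤-trans N≤ (codes≤ (suc q-1) (s≤s 1≤q-1) d m)

theorem1 : ∀ (c ℓ₁ ℓ₂ : Level) (d : ℕ) → 1 ≤ d →
    ∃[ c₁ ] ∃[ c₂ ] 0ℚ ℚ.< c₁ × 0ℚ ℚ.< c₂ ×
    (∀ (k : ℕ) → d ≤ k →
    ∀ (q : ℕ) → IsOddPrimePower q →
    ∀ (F : HeytingField c ℓ₁ ℓ₂) → Configurations.FieldHasOrder F q →
    ∃[ N ] Configurations.ΔHasCardinality F d k U N
    × c₁ ℚ.* fromℕ (q ^ (d * (k + 1) ∸ (d + 1) C 2)) ℚ.≤ fromℕ N
    × fromℕ N ℚ.≤ c₂ ℚ.* fromℕ (q ^ (d * (k + 1) ∸ (d + 1) C 2)))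
theorem1 c ℓ₁ ℓ₂ d _ = c₁ , c₂ , ℚ.positive⁻¹ c₁ , ℚ.positive⁻¹ c₂ , bounds
  where
  instance
    2^d≢0 : NonZero (2 ^ d)
    2^d≢0 = ℕ.m^n≢0 2 d
    4^d≢0 : NonZero (2 ^ d * 2 ^ d)
    4^d≢0 = ℕ.m*n≢0 (2 ^ d) (2 ^ d)
    c₂-positive : ℚ.Positive (fromℕ (2 ^ d))
    c₂-positive = fromℕ-positive (2 ^ d)
    4^d-positive : ℚ.Positive (fromℕ (2 ^ d * 2 ^ d))
    4^d-positive = fromℕ-positive (2 ^ d * 2 ^ d)
    4^d-nonzero : ℚ.NonZero (fromℕ (2 ^ d * 2 ^ d))
    4^d-nonzero = ℚ.pos⇒nonZero (fromℕ (2 ^ d * 2 ^ d))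
  -- In `c₁` one factor 2 ^ d pays for the diagonal signs and the other for the diagonal entries
  -- being nonzero; `c₂` is the factor 2 ^ s of `codes-bound` at s = d.
  c₁ c₂ : ℚ
  c₁ = ℚ.1/ fromℕ (2 ^ d * 2 ^ d)
  c₂ = fromℕ (2 ^ d)
  instance
    c₁-positive : ℚ.Positive c₁
    c₁-positive = ℚ.1/pos⇒pos (fromℕ (2 ^ d * 2 ^ d))
    c₁-nonNegative : ℚ.NonNegative c₁
    c₁-nonNegative = ℚ.pos⇒nonNeg c₁
  lower : ∀ e N → e ≤ 2 ^ d * 2 ^ d * N → c₁ ℚ.* fromℕ e ℚ.≤ fromℕ N
  lower e N e≤ = begin
    c₁ ℚ.* fromℕ e
      ≤⟨ ℚ.*-monoˡ-≤-nonNeg c₁ (fromℕ-mono-≤ e (2 ^ d * 2 ^ d * N) e≤) ⟩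
    c₁ ℚ.* fromℕ (2 ^ d * 2 ^ d * N)                  ≡⟨ ≡.cong (c₁ ℚ.*_) (fromℕ-homo-* (2 ^ d * 2 ^ d) N) ⟩
    c₁ ℚ.* (fromℕ (2 ^ d * 2 ^ d) ℚ.* fromℕ N)        ≡⟨ ℚ.*-assoc c₁ (fromℕ (2 ^ d * 2 ^ d)) (fromℕ N) ⟨
    c₁ ℚ.* fromℕ (2 ^ d * 2 ^ d) ℚ.* fromℕ N
      ≡⟨ ≡.cong (ℚ._* fromℕ N) (ℚ.*-inverseˡ (fromℕ (2 ^ d * 2 ^ d))) ⟩
    ℚ.1ℚ ℚ.* fromℕ N                                  ≡⟨ ℚ.*-identityˡ (fromℕ N) ⟩
    fromℕ N                                           ∎
    where open ℚ.≤-Reasoning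
  upper : ∀ e N → N ≤ 2 ^ d * e → fromℕ N ℚ.≤ c₂ ℚ.* fromℕ e
  upper e N N≤ = ≡.subst (fromℕ N ℚ.≤_) (fromℕ-homo-* (2 ^ d) e) (fromℕ-mono-≤ N (2 ^ d * e) N≤)
  bounds : ∀ (k : ℕ) → d ≤ k →
    ∀ (q : ℕ) → IsOddPrimePower q →
    ∀ (F : HeytingField c ℓ₁ ℓ₂) → Configurations.FieldHasOrder F q →
    ∃[ N ] Configurations.ΔHasCardinality F d k U N
    × c₁ ℚ.* fromℕ (q ^ (d * (k + 1) ∸ (d + 1) C 2)) ℚ.≤ fromℕ N
    × fromℕ N ℚ.≤ c₂ ℚ.* fromℕ (q ^ (d * (k + 1) ∸ (d + 1) C 2))
  bounds k d≤k q odd F order =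
    let m , d+m≡k          = ℕ.m≤n⇒∃[o]m+o≡n d≤k
        2≉0                = odd-order⇒2≉0 F q order (odd-prime-power odd)
        N , card , l , u   = cardinality-bounds d m q (FiniteField.1<q F q order) F order 2≉0
        E≡                 = ≡.trans (≡.cong (λ k → d * (k + 1) ∸ (d + 1) C 2) (≡.sym d+m≡k)) (exponent≡ d m)
    in N ,
       ≡.subst (λ k → Configurations.ΔHasCardinality F d k U N) d+m≡k card ,
       lower (q ^ (d * (k + 1) ∸ (d + 1) C 2)) N (≡.subst (λ e → q ^ e ≤ 2 ^ d * 2 ^ d * N) (≡.sym E≡) l) ,
       upper (q ^ (d * (k + 1) ∸ (d + 1) C 2)) N (≡.subst (λ e → N ≤ 2 ^ d * q ^ e) (≡.sym E≡) u)
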